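{- Let $\dot G$ be a signed graph with spectrum $\{[-\lambda]^m,[0]^1,[\lambda]^m\}$ and suppose every vertex of its underlying graph $G$ has degree $\lambda^2$ or $\lambda^2-1$. Then there is a signed graph $\dot H$ with spectrum $\{[-\lambda]^{m+1},[\lambda]^{m+1}\}$ containing a vertex whose deletion yields $\dot G$ (i.e., $\dot G$ can be extended by one vertex to such a signed graph).
   Context: A signed graph $\dot G=(G,\sigma)$ consists of a simple graph $G$ and $\sigma:E(G)\to\{1,-1\}$; its adjacency matrix is that of $G$ with entries of negative edges replaced by $-1$, and its spectrum is the multiset of eigenvalues of this matrix. The notation $[\mu]^k$ means eigenvalue $\mu$ with multiplicity $k$. -}

module Defs where

open import Data.Nat using (ℕ; zero; suc; _∸_)
open import Data.Integer using (ℤ; _+_; _*_; -_; 0ℤ; 1ℤ; -1ℤ; +_)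
open import Data.Integer.Properties using () renaming (_≟_ to _≟ℤ_)
open import Data.Fin using (Fin; zero; suc; toℕ; punchIn)
open import Data.Fin.Properties using () renaming (_≟_ to _≟F_)
open import Data.List using (List; []; _∷_; map; filter; length)
open import Relation.Nullary using (¬?; yes; no)
open import Relation.Nullary.Decidable using (⌊_⌋)
open import Relation.Binary.PropositionalEquality using (_≡_)
open import Data.Sum using (_⊎_)

-- Polynomials over ℤ: coefficient lists, lowest degree first.

Poly : Set
Poly = List ℤ

coeff : Poly → ℕ → ℤ
coeff []      _       = 0ℤ
coeff (a ∷ p) zero    = a
coeff (a ∷ p) (suc i) = coeff p i

_≈P_ : Poly → Poly → Set
p ≈P q = ∀ i → coeff p i ≡ coeff q i

infixl 6 _+P_
infixl 7 _*P_

_+P_ : Poly → Poly → Poly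
[]      +P q       = q
(a ∷ p) +P []      = a ∷ p
(a ∷ p) +P (b ∷ q) = (a + b) ∷ (p +P q)

scaleP : ℤ → Poly → Poly
scaleP a = map (a *_)

_*P_ : Poly → Poly → Poly
[]      *P q = []
(a ∷ p) *P q = scaleP a q +P (0ℤ ∷ (p *P q))

constP : ℤ → Poly
constP a = a ∷ []

X : Poly
X = 0ℤ ∷ 1ℤ ∷ []

_^P_ : Poly → ℕ → Poly
p ^P zero  = constP 1ℤ
p ^P suc m = p *P (p ^P m)

sumFin : ∀ n → (Fin n → Poly) → Poly
sumFin zero    f = []
sumFin (suc n) f = f zero +P sumFin n (λ j → f (suc j))

altSign : ℕ → ℤ
altSign zero          = 1ℤ
altSign (suc zero)    = -1ℤ
altSign (suc (suc k)) = altSign k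

det : ∀ n → (Fin n → Fin n → Poly) → Poly
det zero    M = constP 1ℤ
det (suc n) M = sumFin (suc n) λ j →
  scaleP (altSign (toℕ j))
    (M zero j *P det n (λ r c → M (suc r) (punchIn j c)))

record SignedGraph (n : ℕ) : Set where
  field
    adj       : Fin n → Fin n → ℤ
    entries   : ∀ i j → (adj i j ≡ 0ℤ) ⊎ ((adj i j ≡ 1ℤ) ⊎ (adj i j ≡ -1ℤ))
    symmetric : ∀ i j → adj i j ≡ adj j i
    loopless  : ∀ i → adj i i ≡ 0ℤ
open SignedGraph public

charPoly : ∀ {n} → SignedGraph n → Poly
charPoly {n} G = det n λ i j →
  (if ⌊ i ≟F j ⌋ then X else []) +P constP (- adj G i j)
  where open import Data.Bool using (if_then_else_)

degree : ∀ {n} → SignedGraph n → Fin n → ℕ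
degree {n} G i = length (filter (λ j → ¬? (adj G i j ≟ℤ 0ℤ)) (Data.List.allFin n))
  where import Data.List

DeletionYields : ∀ {n} → SignedGraph (suc n) → Fin (suc n) → SignedGraph n → Set
DeletionYields H v G = ∀ r c → adj H (punchIn v r) (punchIn v c) ≡ adj G r c

-- x² - k  (its roots are ±λ where λ² = k).
X²-k : ℕ → Poly
X²-k k = X *P X +P constP (- (+ k))

{-# OPTIONS --safe #-}

-- Let A be the adjacency matrix and N = k − A². By Cayley–Hamilton A(A² − k)ᵐ = 0, and
-- A is symmetric, so already A(A² − k) = 0; hence AN = 0 and N² = kN. The diagonal of N
-- is k − deg ∈ {0, 1}. For k ≥ 1, N ≠ 0: otherwise A² = k and det A = 0 would make the
-- adjugate of A zero, and 0 would be a multiple root. So some column u of N has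
-- diagonal entry 1; then Au = 0, ‖u‖² = k, and Cauchy–Schwarz bounds the entries of u
-- by 1 in absolute value. Bordering A with u gives H, and combining the rows of x − H
-- with the coefficients (x, u) yields x det(x − H) = (x² − k) det(x − A).
-- Polynomial identities are checked by evaluation at the positive integers.
module Submission where

open import Defs
open import Data.Nat using (ℕ; zero; suc; _∸_)
import Data.Nat as ℕ
import Data.Nat.Properties as ℕ
open import Data.Integer as ℤ using (ℤ; -_; _+_; _*_; 0ℤ; 1ℤ; -1ℤ)
open import Data.Integer.Properties
open import Data.Integer.Tactic.RingSolver using (solve-∀)
open import Algebra.Properties.Semiring.Sum +-*-semiring
open import Data.Bool using (if_then_else_)
open import Data.Fin using (Fin; zero; suc; toℕ; punchIn)
open import Data.Fin.Properties using (suc-injective; any?) renaming (_≟_ to _≟F_)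
open import Data.List using ([]; _∷_; length; filter; tabulate)
open import Data.Product using (Σ; _×_; _,_; proj₁; proj₂; ∃)
open import Data.Sum using (_⊎_; inj₁; inj₂)
open import Data.Vec.Functional using (updateAt; tail)
open import Data.Vec.Functional.Properties using (map-updateAt; updateAt-updates; updateAt-minimal; updateAt-id-local)
open import Function using (_∘_; const; id)
open import Relation.Nullary using (¬_; yes; no; contradiction; ¬?)
open import Relation.Nullary.Decidable using (⌊_⌋)
open import Relation.Binary.PropositionalEquality
  using (_≡_; _≢_; _≗_; refl; sym; trans; cong; cong₂; subst; cong-app; module ≡-Reasoning)
open ≡-Reasoning

-- Why `u` is the right border: over the reals, N is k times the orthogonal projection onto the
-- kernel of A. For k ≥ 1 that kernel is a line, so N = u uᵀ with ‖u‖² = k. Then A² + u uᵀ = k, Au =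
-- 0 and ‖u‖² = k together say that the square of the bordered matrix is k, and the diagonal entries
-- uᵢ² ∈ {0, 1} of N make every uᵢ equal to 0 or ±1. The obstacle is that λ = √k need not be an
-- integer, so over ℤ there are neither eigenvectors for ±λ nor a diagonalisation. Every step is
-- therefore phrased through A² - k, and the spectrum enters through the characteristic polynomial
-- alone. Positivity of ⟨v, v⟩ does the work of diagonalisation: it removes the exponent m. A column
-- of N with diagonal entry 1 is u up to sign, and Cauchy-Schwarz stands in for the factorisation of
-- N. For k = 0 there is no such column, since A and N both vanish; that case gets the zero border.

private variable
  n : ℕ
  Row : Set

Vector : ℕ → Set
Vector n = Fin n → ℤ

Matrix : ℕ → Set
Matrix n = Fin n → Vector n

infix 4 _≐_
_≐_ : Matrix n → Matrix n → Set
M ≐ N = ∀ r c → M r c ≡ N r c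

infixl 9 _[_≔_]
_[_≔_] : (Fin n → Row) → Fin n → Row → Fin n → Row
M [ i ≔ v ] = updateAt M i (const v)

-- Finite sums of integers

sum-zero : (f : Fin n → ℤ) → (∀ i → f i ≡ 0ℤ) → sum f ≡ 0ℤ
sum-zero {n} f f≡0 = trans (sum-cong-≗ f≡0) (sum-replicate-zero n)

-- The shape `a * f + g` recurs in all linearity lemmas below: one statement covers sums, multiples
-- and, with a = -1, differences. The pointwise hypothesis lets each term be rearranged by a ring
-- identity in the same step.
sum-linear : ∀ a {f g h : Fin n → ℤ} → (∀ i → h i ≡ a * f i + g i) → sum h ≡ a * sum f + sum g
sum-linear a {f} {g} {h} eq = begin
  sum h                                ≡⟨ sum-cong-≗ eq ⟩
  sum (λ i → a * f i + g i)            ≡⟨ ∑-distrib-+ (λ i → a * f i) g ⟩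
  sum (λ i → a * f i) + sum g          ≡⟨ cong (_+ sum g) (*-distribˡ-sum a f) ⟨
  a * sum f + sum g                    ∎

sum-only : ∀ (i : Fin n) {f : Fin n → ℤ} → (∀ j → j ≢ i → f j ≡ 0ℤ) → sum f ≡ f i
sum-only zero {f} off = trans (cong (f zero +_) (sum-zero (f ∘ suc) (λ j → off (suc j) λ ()))) (+-identityʳ (f zero))
sum-only (suc i) {f} off = begin
  f zero + sum (f ∘ suc)  ≡⟨ cong₂ _+_ (off zero λ ()) (sum-only i (λ j j≢i → off (suc j) (j≢i ∘ suc-injective))) ⟩
  0ℤ + f (suc i)          ≡⟨ +-identityˡ (f (suc i)) ⟩
  f (suc i)               ∎

-- Determinants over ℤ

minor : Matrix (suc n) → Fin (suc n) → Matrix n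
minor M j r c = M (suc r) (punchIn j c)

-- Mirrors the first-row expansion of `det` term by term, so that evaluation at an integer passes
-- through it entrywise.
detℤ : ∀ n → Matrix n → ℤ
detℤ zero    M = 1ℤ
detℤ (suc n) M = ∑[ j < suc n ] (altSign (toℕ j) * (M zero j * detℤ n (minor M j)))

det-cong : {M N : Matrix n} → M ≐ N → detℤ n M ≡ detℤ n N
det-cong {zero}  M≐N = refl
det-cong {suc n} M≐N = sum-cong-≗ λ j → cong (altSign (toℕ j) *_)
  (cong₂ _*_ (M≐N zero j) (det-cong λ r c → M≐N (suc r) (punchIn j c)))

minor-update : (M : Matrix (suc n)) (i : Fin n) (v : Fin (suc n) → ℤ) (j : Fin (suc n)) →
               minor (M [ suc i ≔ v ]) j ≐ minor M j [ i ≔ v ∘ punchIn j ]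
minor-update M i v j r c = cong-app (map-updateAt {f = _∘ punchIn j} {g = const v} {h = const (v ∘ punchIn j)} (λ _ → refl) (tail M) i r) c

update-cong : ∀ {m} (M : Fin m → Vector n) (i : Fin m) {v w : Vector n} → v ≗ w →
              ∀ r c → (M [ i ≔ v ]) r c ≡ (M [ i ≔ w ]) r c
update-cong M zero    v≗w zero    c = v≗w c
update-cong M zero    v≗w (suc r) c = refl
update-cong M (suc i) v≗w zero    c = refl
update-cong M (suc i) v≗w (suc r) c = update-cong (tail M) i v≗w r c

det-linear : (M : Matrix n) (i : Fin n) (a : ℤ) (v w : Fin n → ℤ) →
             detℤ n (M [ i ≔ (λ c → a * v c + w c) ]) ≡ a * detℤ n (M [ i ≔ v ]) + detℤ n (M [ i ≔ w ])
det-linear {suc n} M zero a v w = sum-linear a λ j → eq (altSign (toℕ j)) a (v j) (w j) (detℤ n (minor M j))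
  where
  eq : ∀ s a x y d → s * ((a * x + y) * d) ≡ a * (s * (x * d)) + s * (y * d)
  eq = solve-∀
det-linear {suc n} M (suc i) a v w = sum-linear a λ j → begin
  altSign (toℕ j) * (M zero j * detℤ n (minor (M [ suc i ≔ (λ c → a * v c + w c) ]) j))
    ≡⟨ cong (λ d → altSign (toℕ j) * (M zero j * d)) (det-cong (minor-update M i _ j)) ⟩
  altSign (toℕ j) * (M zero j * detℤ n (minor M j [ i ≔ (λ c → a * v (punchIn j c) + w (punchIn j c)) ]))
    ≡⟨ cong (λ d → altSign (toℕ j) * (M zero j * d)) (det-linear (minor M j) i a (v ∘ punchIn j) (w ∘ punchIn j)) ⟩
  altSign (toℕ j) * (M zero j * (a * detℤ n (minor M j [ i ≔ v ∘ punchIn j ]) + detℤ n (minor M j [ i ≔ w ∘ punchIn j ])))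
    ≡⟨ eq (altSign (toℕ j)) (M zero j) a _ _ ⟩
  a * (altSign (toℕ j) * (M zero j * detℤ n (minor M j [ i ≔ v ∘ punchIn j ]))) + altSign (toℕ j) * (M zero j * detℤ n (minor M j [ i ≔ w ∘ punchIn j ]))
    ≡⟨ cong₂ (λ d e → a * (altSign (toℕ j) * (M zero j * d)) + altSign (toℕ j) * (M zero j * e))
         (det-cong (minor-update M i v j)) (det-cong (minor-update M i w j)) ⟨
  a * (altSign (toℕ j) * (M zero j * detℤ n (minor (M [ suc i ≔ v ]) j))) + altSign (toℕ j) * (M zero j * detℤ n (minor (M [ suc i ≔ w ]) j)) ∎
  where
  eq : ∀ s m a d e → s * (m * (a * d + e)) ≡ a * (s * (m * d)) + s * (m * e)
  eq = solve-∀

det-zero-row : (M : Matrix n) (i : Fin n) → detℤ n (M [ i ≔ const 0ℤ ]) ≡ 0ℤ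
det-zero-row {n} M i = begin
  -- `-1ℤ * 0ℤ + 0ℤ` computes to `0ℤ`, so the combined row is again the zero row.
  d          ≡⟨ det-linear M i -1ℤ (const 0ℤ) (const 0ℤ) ⟩
  -1ℤ * d + d ≡⟨ eq d ⟩
  0ℤ         ∎
  where
  d = detℤ n (M [ i ≔ const 0ℤ ])
  eq : ∀ d → -1ℤ * d + d ≡ 0ℤ
  eq = solve-∀

det-sum : (M : Matrix n) (i : Fin n) {m : ℕ} (t : Fin m → ℤ) (w : Fin m → Fin n → ℤ) →
          detℤ n (M [ i ≔ (λ c → ∑[ j < m ] (t j * w j c)) ]) ≡ ∑[ j < m ] (t j * detℤ n (M [ i ≔ w j ]))
det-sum M i {zero}  t w = det-zero-row M i
det-sum {n} M i {suc m} t w = trans (det-linear M i (t zero) (w zero) _)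
  (cong (t zero * detℤ n (M [ i ≔ w zero ]) +_) (det-sum M i (t ∘ suc) (w ∘ suc)))

-- Determinants with two equal rows vanish

altSign-suc : ∀ i → altSign (suc i) ≡ - altSign i
altSign-suc zero          = refl
altSign-suc (suc zero)    = refl
altSign-suc (suc (suc i)) = altSign-suc i

-- Once the pairs through column zero have cancelled, column zero belongs to every remaining minor.
-- Keeping it fixed turns the remaining terms into a double expansion over the other columns.
extend : ∀ {m} → (Fin m → Fin n) → Fin (suc m) → Fin (suc n)
extend c zero    = zero
extend c (suc i) = suc (c i)

-- Swapping the two chosen columns pairs the terms off with opposite signs; the
-- induction cancels the pairs containing column zero.
double-expansion-zero :
  ∀ n (a : Fin (suc (suc n)) → ℤ) (G : (Fin n → Fin (suc (suc n))) → ℤ) →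
  (∀ {c d} → (∀ i → c i ≡ d i) → G c ≡ G d) →
  ∑[ j < suc (suc n) ] (altSign (toℕ j) * (a j *
    ∑[ l < suc n ] (altSign (toℕ l) * (a (punchIn j l) * G (punchIn j ∘ punchIn l))))) ≡ 0ℤ
double-expansion-zero n a G G-cong = begin
  1ℤ * (a zero * ∑[ l < suc n ] (s l * (a (suc l) * H l)))
    + ∑[ j < suc n ] (altSign (suc (toℕ j)) * (a (suc j) * (1ℤ * (a zero * G (punchIn (suc j) ∘ suc)) + R j)))
    ≡⟨ cong₂ _+_ first (sum-cong-≗ rest) ⟩
  ∑[ l < suc n ] (a zero * (s l * (a (suc l) * H l)))
    + ∑[ j < suc n ] (-1ℤ * (a zero * (s j * (a (suc j) * H j))) + T j)
    ≡⟨ cong (sum (λ l → a zero * (s l * (a (suc l) * H l))) +_)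
         (sum-linear -1ℤ {λ l → a zero * (s l * (a (suc l) * H l))} {T} (λ _ → refl)) ⟩
  U + (-1ℤ * U + sum T)
    ≡⟨ cancel U (sum T) ⟩
  sum T
    ≡⟨ remainder n a G G-cong ⟩
  0ℤ ∎
  where
  s : ∀ {m} → Fin m → ℤ
  s l = altSign (toℕ l)
  H : Fin (suc n) → ℤ
  H l = G (suc ∘ punchIn l)
  U = ∑[ l < suc n ] (a zero * (s l * (a (suc l) * H l)))
  R : Fin (suc n) → ℤ
  R j = ∑[ l < n ] (altSign (suc (toℕ l)) * (a (suc (punchIn j l)) * G (punchIn (suc j) ∘ punchIn (suc l))))
  T : Fin (suc n) → ℤ
  T j = altSign (suc (toℕ j)) * (a (suc j) * R j)
  cancel : ∀ x y → x + (-1ℤ * x + y) ≡ y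
  cancel = solve-∀
  first : 1ℤ * (a zero * ∑[ l < suc n ] (s l * (a (suc l) * H l))) ≡ U
  first = trans (*-identityˡ _) (*-distribˡ-sum (a zero) (λ l → s l * (a (suc l) * H l)))
  expand : ∀ s b z h r → - s * (b * (1ℤ * (z * h) + r)) ≡ -1ℤ * (z * (s * (b * h))) + - s * (b * r)
  expand = solve-∀
  rest : ∀ j → altSign (suc (toℕ j)) * (a (suc j) * (1ℤ * (a zero * G (punchIn (suc j) ∘ suc)) + R j))
             ≡ -1ℤ * (a zero * (s j * (a (suc j) * H j))) + T j
  rest j rewrite altSign-suc (toℕ j) = expand (s j) (a (suc j)) (a zero) (H j) (R j)
  remainder : ∀ n (a : Fin (suc (suc n)) → ℤ) (G : (Fin n → Fin (suc (suc n))) → ℤ) →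
    (∀ {c d} → (∀ i → c i ≡ d i) → G c ≡ G d) →
    ∑[ j < suc n ] (altSign (suc (toℕ j)) * (a (suc j) *
      ∑[ l < n ] (altSign (suc (toℕ l)) * (a (suc (punchIn j l)) * G (punchIn (suc j) ∘ punchIn (suc l)))))) ≡ 0ℤ
  remainder zero a G G-cong = cong (λ z → -1ℤ * z + 0ℤ) (*-zeroʳ (a (suc zero)))
  remainder (suc n) a G G-cong = trans (sum-cong-≗ outer)
    (double-expansion-zero n (a ∘ suc) (G ∘ extend) λ c≗d → G-cong λ { zero → refl ; (suc i) → cong suc (c≗d i) })
    where
    signs : ∀ s b r → - s * (b * (-1ℤ * r)) ≡ s * (b * r)
    signs = solve-∀
    sign : ∀ s b r → - s * (b * r) ≡ -1ℤ * (s * (b * r))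
    sign = solve-∀
    inner : ∀ j l →
      altSign (suc (toℕ l)) * (a (suc (punchIn j l)) * G (punchIn (suc j) ∘ punchIn (suc l)))
      ≡ -1ℤ * (altSign (toℕ l) * (a (suc (punchIn j l)) * G (extend (punchIn j ∘ punchIn l))))
    inner j l rewrite altSign-suc (toℕ l) =
      trans (sign (altSign (toℕ l)) (a (suc (punchIn j l))) _)
        (cong (λ g → -1ℤ * (altSign (toℕ l) * (a (suc (punchIn j l)) * g)))
          (G-cong λ { zero → refl ; (suc i) → refl }))
    outer : ∀ j →
      altSign (suc (toℕ j)) * (a (suc j) * ∑[ l < suc n ] (altSign (suc (toℕ l)) * (a (suc (punchIn j l)) * G (punchIn (suc j) ∘ punchIn (suc l)))))
      ≡ altSign (toℕ j) * (a (suc j) * ∑[ l < suc n ] (altSign (toℕ l) * (a (suc (punchIn j l)) * G (extend (punchIn j ∘ punchIn l)))))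
    outer j rewrite altSign-suc (toℕ j) =
      trans (cong (λ r → - altSign (toℕ j) * (a (suc j) * r))
              (trans (sum-cong-≗ (inner j)) (sym (*-distribˡ-sum -1ℤ (λ l → altSign (toℕ l) * (a (suc (punchIn j l)) * G (extend (punchIn j ∘ punchIn l))))))))
            (signs (altSign (toℕ j)) (a (suc j)) _)

-- Expanding along both equal rows gives a double expansion with one coefficient vector; the
-- complementary minor depends only on the columns left over.
det-alternating-head : (M : Matrix (suc (suc n))) → (∀ c → M zero c ≡ M (suc zero) c) → detℤ (suc (suc n)) M ≡ 0ℤ
det-alternating-head {n} M eq = trans
  (sum-cong-≗ λ j → cong (λ x → altSign (toℕ j) * (x * detℤ (suc n) (minor M j))) (eq j))
  (double-expansion-zero n (M (suc zero)) (λ c → detℤ n (λ r i → M (suc (suc r)) (c i)))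
    λ c≗d → det-cong λ r i → cong (M (suc (suc r))) (c≗d i))

Alternating : ℕ → Set
Alternating n = (M : Matrix n) {i k : Fin n} → i ≢ k → (∀ c → M i c ≡ M k c) → detℤ n M ≡ 0ℤ

-- Both equal rows lie below the row of expansion, so every minor inherits them.
det-alternating-tail : Alternating n → (M : Matrix (suc n)) {i k : Fin n} → i ≢ k → (∀ c → M (suc i) c ≡ M (suc k) c) → detℤ (suc n) M ≡ 0ℤ
det-alternating-tail alt M i≢k eq = sum-zero _ λ j → begin
  altSign (toℕ j) * (M zero j * detℤ _ (minor M j))
    ≡⟨ cong (λ d → altSign (toℕ j) * (M zero j * d)) (alt (minor M j) i≢k (eq ∘ punchIn j)) ⟩
  altSign (toℕ j) * (M zero j * 0ℤ)
    ≡⟨ eq0 (altSign (toℕ j)) (M zero j) ⟩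
  0ℤ ∎
  where
  eq0 : ∀ s m → s * (m * 0ℤ) ≡ 0ℤ
  eq0 = solve-∀

-- Polarisation: f x y is the determinant with x in row 1 and y in row k; it
-- vanishes on the diagonal, so f (M 1) (M 0) is −f (M 0) (M 1), which has equal rows 0 and 1.
det-alternating-zero : Alternating n → (M : Matrix (suc n)) (k : Fin n) → (∀ c → M zero c ≡ M (suc k) c) → detℤ (suc n) M ≡ 0ℤ
det-alternating-zero {suc n} alt M zero eq = det-alternating-head M eq
det-alternating-zero {suc n} alt M (suc k) eq = begin
  detℤ _ M          ≡⟨ det-cong same ⟩
  f w v             ≡⟨ isolate (f v v) (f v w) (f w v) (f w w) ⟩
  (1ℤ * (1ℤ * f v v + f v w) + (1ℤ * f w v + f w w)) + - f v v + - f v w + - f w w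
                    ≡⟨ cong (λ z → z + - f v v + - f v w + - f w w) (sym bilinear) ⟩
  f v+w v+w + - f v v + - f v w + - f w w
                    ≡⟨ cong₂ (λ p q → p + q + - f v w + - f w w) (diag v+w) (cong -_ (diag v)) ⟩
  0ℤ + - f v w + - f w w
                    ≡⟨ cong₂ (λ p q → 0ℤ + - p + - q) (det-alternating-head (N v w) λ c → refl) (diag w) ⟩
  0ℤ ∎
  where
  N : (x y : Fin (suc (suc n)) → ℤ) → Matrix (suc (suc n))
  N x y = M [ suc zero ≔ x ] [ suc (suc k) ≔ y ]
  f : (x y : Fin (suc (suc n)) → ℤ) → ℤ
  f x y = detℤ (suc (suc n)) (N x y)
  v w v+w : Fin (suc (suc n)) → ℤ
  v = M zero
  w = M (suc zero)
  v+w c = 1ℤ * v c + w c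
  same : M ≐ N w v
  same zero          c = refl
  same (suc zero)    c = refl
  same (suc (suc r)) c = go r
    where
    go : ∀ r → M (suc (suc r)) c ≡ updateAt (tail (tail M)) k (const v) r c
    go r with r ≟F k
    ... | yes refl = trans (sym (eq c)) (sym (cong-app (updateAt-updates r (tail (tail M))) c))
    ... | no r≢k   = sym (cong-app (updateAt-minimal r k (tail (tail M)) r≢k) c)
  diag : ∀ x → f x x ≡ 0ℤ
  diag x = det-alternating-tail alt (N x x) {zero} {suc k} (λ ())
    λ c → sym (cong-app (updateAt-updates k (tail (tail M))) c)
  swap : ∀ x y → N x y ≐ M [ suc (suc k) ≔ y ] [ suc zero ≔ x ]
  swap x y zero          c = refl
  swap x y (suc zero)    c = refl
  swap x y (suc (suc r)) c = refl
  bilinear : f v+w v+w ≡ 1ℤ * (1ℤ * f v v + f v w) + (1ℤ * f w v + f w w)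
  bilinear = begin
    f v+w v+w
      ≡⟨ det-cong (swap v+w v+w) ⟩
    detℤ _ (M [ suc (suc k) ≔ v+w ] [ suc zero ≔ v+w ])
      ≡⟨ det-linear (M [ suc (suc k) ≔ v+w ]) (suc zero) 1ℤ v w ⟩
    1ℤ * detℤ _ (M [ suc (suc k) ≔ v+w ] [ suc zero ≔ v ]) + detℤ _ (M [ suc (suc k) ≔ v+w ] [ suc zero ≔ w ])
      ≡⟨ cong₂ (λ p q → 1ℤ * p + q) (det-cong (swap v v+w)) (det-cong (swap w v+w)) ⟨
    1ℤ * f v v+w + f w v+w
      ≡⟨ cong₂ (λ p q → 1ℤ * p + q)
           (det-linear (M [ suc zero ≔ v ]) (suc (suc k)) 1ℤ v w)
           (det-linear (M [ suc zero ≔ w ]) (suc (suc k)) 1ℤ v w) ⟩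
    1ℤ * (1ℤ * f v v + f v w) + (1ℤ * f w v + f w w) ∎
  isolate : ∀ a b c d → c ≡ (1ℤ * (1ℤ * a + b) + (1ℤ * c + d)) + - a + - b + - d
  isolate = solve-∀

det-alternating : Alternating n
det-alternating {suc n} M {zero}  {zero}  i≢k eq = contradiction refl i≢k
det-alternating {suc n} M {zero}  {suc k} i≢k eq = det-alternating-zero det-alternating M k eq
det-alternating {suc n} M {suc i} {zero}  i≢k eq = det-alternating-zero det-alternating M i (sym ∘ eq)
det-alternating {suc n} M {suc i} {suc k} i≢k eq = det-alternating-tail det-alternating M (i≢k ∘ cong suc) eq

-- Unit vectors, cofactors and expansion along any row

δ : Matrix n
δ zero    zero    = 1ℤ
δ zero    (suc j) = 0ℤ
δ (suc i) zero    = 0ℤ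
δ (suc i) (suc j) = δ i j

δ-diag : (i : Fin n) → δ i i ≡ 1ℤ
δ-diag zero    = refl
δ-diag (suc i) = δ-diag i

δ-off : {i j : Fin n} → i ≢ j → δ i j ≡ 0ℤ
δ-off {i = zero}  {zero}  i≢j = contradiction refl i≢j
δ-off {i = zero}  {suc j} i≢j = refl
δ-off {i = suc i} {zero}  i≢j = refl
δ-off {i = suc i} {suc j} i≢j = δ-off (i≢j ∘ cong suc)

sum-δʳ : (f : Fin n → ℤ) (i : Fin n) → ∑[ j < n ] (f j * δ j i) ≡ f i
sum-δʳ f i = trans (sum-only i λ j j≢i → trans (cong (f j *_) (δ-off j≢i)) (*-zeroʳ (f j)))
                   (trans (cong (f i *_) (δ-diag i)) (*-identityʳ (f i)))

-- This is the cofactor of entry (i, j), hence the transpose of the classical adjugate: the vector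
-- `adjugate M i` is sent by M to det M times the i-th unit vector.
adjugate : Matrix n → Matrix n
adjugate M i j = detℤ _ (M [ i ≔ δ j ])

det-row : (M : Matrix n) (i : Fin n) (v : Fin n → ℤ) → ∑[ j < n ] (v j * adjugate M i j) ≡ detℤ n (M [ i ≔ v ])
det-row M i v = trans (sym (det-sum M i v δ)) (det-cong (update-cong M i (sum-δʳ v)))

adjugate-diag : (M : Matrix n) (i : Fin n) → ∑[ j < n ] (M i j * adjugate M i j) ≡ detℤ n M
adjugate-diag M i = trans (det-row M i (M i)) (det-cong λ r c → cong-app (updateAt-id-local i M refl r) c)

-- Pairing the cofactors of row i with row k computes a determinant in which row k occurs twice.
adjugate-off : (M : Matrix n) {i k : Fin n} → i ≢ k → ∑[ j < n ] (M k j * adjugate M i j) ≡ 0ℤ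
adjugate-off M {i} {k} i≢k = trans (det-row M i (M k)) (det-alternating _ i≢k λ c →
  trans (cong-app (updateAt-updates i M) c) (sym (cong-app (updateAt-minimal k i M (i≢k ∘ sym)) c)))

-- Evaluation of polynomials

eval : Poly → ℤ → ℤ
eval []      x = 0ℤ
eval (a ∷ p) x = a + x * eval p x

eval-+P : ∀ p q x → eval (p +P q) x ≡ eval p x + eval q x
eval-+P []      q       x = sym (+-identityˡ _)
eval-+P (a ∷ p) []      x = sym (+-identityʳ _)
eval-+P (a ∷ p) (b ∷ q) x = trans (cong (λ e → a + b + x * e) (eval-+P p q x)) (eq a b x _ _)
  where
  eq : ∀ a b x e f → a + b + x * (e + f) ≡ (a + x * e) + (b + x * f)
  eq = solve-∀

eval-scaleP : ∀ a p x → eval (scaleP a p) x ≡ a * eval p x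
eval-scaleP a []      x = sym (*-zeroʳ a)
eval-scaleP a (b ∷ p) x = trans (cong (λ e → a * b + x * e) (eval-scaleP a p x)) (eq a b x _)
  where
  eq : ∀ a b x e → a * b + x * (a * e) ≡ a * (b + x * e)
  eq = solve-∀

eval-*P : ∀ p q x → eval (p *P q) x ≡ eval p x * eval q x
eval-*P []      q x = sym (*-zeroˡ (eval q x))
eval-*P (a ∷ p) q x = begin
  eval (scaleP a q +P (0ℤ ∷ p *P q)) x      ≡⟨ eval-+P (scaleP a q) (0ℤ ∷ p *P q) x ⟩
  eval (scaleP a q) x + (0ℤ + x * eval (p *P q) x)
    ≡⟨ cong₂ (λ e f → e + (0ℤ + x * f)) (eval-scaleP a q x) (eval-*P p q x) ⟩
  a * eval q x + (0ℤ + x * (eval p x * eval q x)) ≡⟨ eq a x (eval p x) (eval q x) ⟩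
  (a + x * eval p x) * eval q x             ∎
  where
  eq : ∀ a x e f → a * f + (0ℤ + x * (e * f)) ≡ (a + x * e) * f
  eq = solve-∀

eval-constP : ∀ a x → eval (constP a) x ≡ a
eval-constP a x = trans (cong (a +_) (*-zeroʳ x)) (+-identityʳ a)

eval-X : ∀ x → eval X x ≡ x
eval-X = eq
  where
  eq : ∀ x → 0ℤ + x * (1ℤ + x * 0ℤ) ≡ x
  eq = solve-∀

eval-^P : ∀ p m x → eval (p ^P m) x ≡ eval p x ℤ.^ m
eval-^P p zero    x = eval-constP 1ℤ x
eval-^P p (suc m) x = trans (eval-*P p (p ^P m) x) (cong (eval p x *_) (eval-^P p m x))

eval-X²-k : ∀ k x → eval (X²-k k) x ≡ x * x + - (ℤ.+ k)
eval-X²-k k x = trans (eval-+P (X *P X) (constP (- (ℤ.+ k))) x)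
  (cong₂ _+_ (trans (eval-*P X X x) (cong₂ _*_ (eval-X x) (eval-X x))) (eval-constP _ x))

eval-sumFin : ∀ n (f : Fin n → Poly) x → eval (sumFin n f) x ≡ ∑[ j < n ] (eval (f j) x)
eval-sumFin zero    f x = refl
eval-sumFin (suc n) f x = trans (eval-+P (f zero) (sumFin n (f ∘ suc)) x) (cong (eval (f zero) x +_) (eval-sumFin n (f ∘ suc) x))

eval-det : ∀ n (M : Fin n → Fin n → Poly) x → eval (det n M) x ≡ detℤ n (λ i j → eval (M i j) x)
eval-det zero    M x = eval-constP 1ℤ x
eval-det (suc n) M x = trans (eval-sumFin (suc n) term x) (sum-cong-≗ λ j →
  trans (eval-scaleP (altSign (toℕ j)) (M zero j *P cofactor j) x)
    (cong (altSign (toℕ j) *_) (trans (eval-*P (M zero j) (cofactor j) x)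
      (cong (eval (M zero j) x *_) (eval-det n (λ r c → M (suc r) (punchIn j c)) x)))))
  where
  cofactor term : Fin (suc n) → Poly
  cofactor j = det n (λ r c → M (suc r) (punchIn j c))
  term j = scaleP (altSign (toℕ j)) (M zero j *P cofactor j)

eval-zero : ∀ p x → p ≈P [] → eval p x ≡ 0ℤ
eval-zero []      x p≈0 = refl
eval-zero (a ∷ p) x p≈0 = trans (cong₂ (λ a e → a + x * e) (p≈0 0) (eval-zero p x (p≈0 ∘ suc)))
                                (trans (+-identityˡ _) (*-zeroʳ x))

eval-cong : ∀ p q x → p ≈P q → eval p x ≡ eval q x
eval-cong []      q       x p≈q = sym (eval-zero q x (sym ∘ p≈q))
eval-cong (a ∷ p) []      x p≈q = eval-zero (a ∷ p) x p≈q
eval-cong (a ∷ p) (b ∷ q) x p≈q = cong₂ (λ a e → a + x * e) (p≈q 0) (eval-cong p q x (p≈q ∘ suc))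

coeff-+P : ∀ p q i → coeff (p +P q) i ≡ coeff p i + coeff q i
coeff-+P []      q       i       = sym (+-identityˡ _)
coeff-+P (a ∷ p) []      i       = sym (+-identityʳ _)
coeff-+P (a ∷ p) (b ∷ q) zero    = refl
coeff-+P (a ∷ p) (b ∷ q) (suc i) = coeff-+P p q i

coeff-scaleP : ∀ a p i → coeff (scaleP a p) i ≡ a * coeff p i
coeff-scaleP a []      i       = sym (*-zeroʳ a)
coeff-scaleP a (b ∷ p) zero    = refl
coeff-scaleP a (b ∷ p) (suc i) = coeff-scaleP a p i

suc-multiple-zero : ∀ a e → a ≡ suc a ℕ.* e → a ≡ 0
suc-multiple-zero a zero    eq = trans eq (ℕ.*-zeroʳ (suc a))
suc-multiple-zero a (suc e) eq = contradiction (subst (suc a ℕ.≤_) (sym eq) (ℕ.m≤m*n (suc a) (suc e))) (ℕ.<-irrefl refl)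

a+b≡0⇒a≡-b : ∀ a b → a + b ≡ 0ℤ → a ≡ - b
a+b≡0⇒a≡-b a b eq = trans (shift a b) (trans (cong (_+ - b) eq) (+-identityˡ (- b)))
  where
  shift : ∀ a b → a ≡ a + b + - b
  shift = solve-∀

-- The constant coefficient a is divisible by every positive x, in particular by ∣a∣ + 1.
vanishing⇒zero : ∀ p → (∀ y → eval p ℤ.+[1+ y ] ≡ 0ℤ) → p ≈P []
vanishing⇒zero []      vanish i = refl
vanishing⇒zero (a ∷ p) vanish = λ { zero → a≡0 ; (suc i) → vanishing⇒zero p rest i }
  where
  x = ℤ.+[1+ ℤ.∣ a ∣ ]
  a≡0 : a ≡ 0ℤ
  a≡0 = ∣i∣≡0⇒i≡0 (suc-multiple-zero ℤ.∣ a ∣ ℤ.∣ eval p x ∣ (begin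
    ℤ.∣ a ∣                    ≡⟨ cong ℤ.∣_∣ (a+b≡0⇒a≡-b a (x * eval p x) (vanish _)) ⟩
    ℤ.∣ - (x * eval p x) ∣     ≡⟨ ∣-i∣≡∣i∣ (x * eval p x) ⟩
    ℤ.∣ x * eval p x ∣         ≡⟨ abs-* x (eval p x) ⟩
    suc ℤ.∣ a ∣ ℕ.* ℤ.∣ eval p x ∣ ∎))
  rest : ∀ y → eval p ℤ.+[1+ y ] ≡ 0ℤ
  -- The evaluation points are positive so that this factor can be cancelled.
  rest y = *-cancelˡ-≡ ℤ.+[1+ y ] _ _ (begin
    ℤ.+[1+ y ] * eval p ℤ.+[1+ y ]      ≡⟨ +-identityˡ _ ⟨
    0ℤ + ℤ.+[1+ y ] * eval p ℤ.+[1+ y ] ≡⟨ cong (_+ ℤ.+[1+ y ] * eval p ℤ.+[1+ y ]) a≡0 ⟨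
    eval (a ∷ p) ℤ.+[1+ y ]             ≡⟨ vanish y ⟩
    0ℤ                                  ≡⟨ *-zeroʳ ℤ.+[1+ y ] ⟨
    ℤ.+[1+ y ] * 0ℤ                     ∎)

eval-injective : ∀ p q → (∀ y → eval p ℤ.+[1+ y ] ≡ eval q ℤ.+[1+ y ]) → p ≈P q
eval-injective p q eq i = begin
  coeff p i                            ≡⟨ split (coeff p i) (coeff q i) ⟩
  coeff p i + -1ℤ * coeff q i + coeff q i
    ≡⟨ cong (λ c → coeff p i + c + coeff q i) (coeff-scaleP -1ℤ q i) ⟨
  coeff p i + coeff (scaleP -1ℤ q) i + coeff q i
    ≡⟨ cong (_+ coeff q i) (coeff-+P p (scaleP -1ℤ q) i) ⟨
  coeff (p +P scaleP -1ℤ q) i + coeff q i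
    ≡⟨ cong (_+ coeff q i) (vanishing⇒zero (p +P scaleP -1ℤ q) vanish i) ⟩
  0ℤ + coeff q i                       ≡⟨ +-identityˡ _ ⟩
  coeff q i                            ∎
  where
  split : ∀ a b → a ≡ a + -1ℤ * b + b
  split = solve-∀
  cancel : ∀ a → a + -1ℤ * a ≡ 0ℤ
  cancel = solve-∀
  vanish : ∀ y → eval (p +P scaleP -1ℤ q) ℤ.+[1+ y ] ≡ 0ℤ
  vanish y = begin
    eval (p +P scaleP -1ℤ q) x       ≡⟨ eval-+P p (scaleP -1ℤ q) x ⟩
    eval p x + eval (scaleP -1ℤ q) x ≡⟨ cong₂ _+_ (eq y) (eval-scaleP -1ℤ q x) ⟩
    eval q x + -1ℤ * eval q x        ≡⟨ cancel (eval q x) ⟩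
    0ℤ                               ∎
    where x = ℤ.+[1+ y ]

-- Polynomials acting on vectors; the Cayley–Hamilton theorem

infixr 8 _·_
_·_ : Matrix n → Vector n → Vector n
(M · v) i = ∑[ j < _ ] (M i j * v j)

·-cong : (M : Matrix n) {v w : Vector n} → v ≗ w → M · v ≗ M · w
·-cong M v≗w i = sum-cong-≗ λ j → cong (M i j *_) (v≗w j)

·-linear : (M : Matrix n) (a : ℤ) (v w : Vector n) (i : Fin n) →
           (M · (λ j → a * v j + w j)) i ≡ a * (M · v) i + (M · w) i
·-linear M a v w i = sum-linear a λ j → eq a (M i j) (v j) (w j)
  where
  eq : ∀ a m x y → m * (a * x + y) ≡ a * (m * x) + m * y
  eq = solve-∀

·-zero : (M : Matrix n) {v : Vector n} → v ≗ const 0ℤ → M · v ≗ const 0ℤ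
·-zero M v≗0 i = sum-zero _ λ j → trans (cong (M i j *_) (v≗0 j)) (*-zeroʳ (M i j))

-- The vector p(M) v in Horner form. Acting on vectors makes matrix products and powers unnecessary:
-- multiplication of polynomials becomes composition.
act : Matrix n → Poly → Vector n → Vector n
act M []      v l = 0ℤ
act M (a ∷ p) v l = a * v l + (M · act M p v) l

act-zero : (M : Matrix n) → ∀ p v → p ≈P [] → act M p v ≗ const 0ℤ
act-zero M []      v p≈0 l = refl
act-zero M (a ∷ p) v p≈0 l = begin
  a * v l + (M · act M p v) l ≡⟨ cong₂ (λ a e → a * v l + e) (p≈0 0) (·-zero M (act-zero M p v (p≈0 ∘ suc)) l) ⟩
  0ℤ * v l + 0ℤ               ≡⟨ +-identityʳ (0ℤ * v l) ⟩
  0ℤ * v l                    ≡⟨ *-zeroˡ (v l) ⟩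
  0ℤ                          ∎

act-congˡ : (M : Matrix n) → ∀ p q v → p ≈P q → act M p v ≗ act M q v
act-congˡ M []      q       v p≈q l = sym (act-zero M q v (sym ∘ p≈q) l)
act-congˡ M (a ∷ p) []      v p≈q l = act-zero M (a ∷ p) v p≈q l
act-congˡ M (a ∷ p) (b ∷ q) v p≈q l =
  cong₂ (λ a e → a * v l + e) (p≈q 0) (·-cong M (act-congˡ M p q v (p≈q ∘ suc)) l)

act-congʳ : (M : Matrix n) → ∀ p {v w} → v ≗ w → act M p v ≗ act M p w
act-congʳ M []      v≗w l = refl
act-congʳ M (a ∷ p) v≗w l = cong₂ (λ x e → a * x + e) (v≗w l) (·-cong M (act-congʳ M p v≗w) l)

act-linear : (M : Matrix n) → ∀ p (t : ℤ) (v w : Vector n) (l : Fin n) →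
             act M p (λ j → t * v j + w j) l ≡ t * act M p v l + act M p w l
act-linear M []      t v w l = sym (trans (+-identityʳ (t * 0ℤ)) (*-zeroʳ t))
act-linear M (a ∷ p) t v w l = begin
  a * (t * v l + w l) + (M · act M p (λ j → t * v j + w j)) l
    ≡⟨ cong (a * (t * v l + w l) +_) (·-cong M (act-linear M p t v w) l) ⟩
  a * (t * v l + w l) + (M · (λ j → t * act M p v j + act M p w j)) l
    ≡⟨ cong (a * (t * v l + w l) +_) (·-linear M t (act M p v) (act M p w) l) ⟩
  a * (t * v l + w l) + (t * (M · act M p v) l + (M · act M p w) l)
    ≡⟨ eq a t (v l) (w l) _ _ ⟩
  t * (a * v l + (M · act M p v) l) + (a * w l + (M · act M p w) l) ∎
  where
  eq : ∀ a t x y e f → a * (t * x + y) + (t * e + f) ≡ t * (a * x + e) + (a * y + f)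
  eq = solve-∀

act-0 : (M : Matrix n) → ∀ p {v} → v ≗ const 0ℤ → act M p v ≗ const 0ℤ
act-0 M []      v≗0 l = refl
act-0 M (a ∷ p) v≗0 l = cong₂ _+_ (trans (cong (a *_) (v≗0 l)) (*-zeroʳ a)) (·-zero M (act-0 M p v≗0) l)

act-sum : (M : Matrix n) → ∀ p {m} (v : Fin m → Vector n) (l : Fin n) →
          act M p (λ j → ∑[ k < m ] (v k j)) l ≡ ∑[ k < m ] (act M p (v k) l)
act-sum M p {zero}  v l = act-0 M p (λ _ → refl) l
act-sum M p {suc m} v l = begin
  act M p (λ j → v zero j + rest j) l
    ≡⟨ act-congʳ M p (λ j → cong (_+ rest j) (sym (*-identityˡ (v zero j)))) l ⟩
  act M p (λ j → 1ℤ * v zero j + rest j) l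
    ≡⟨ act-linear M p 1ℤ (v zero) rest l ⟩
  1ℤ * act M p (v zero) l + act M p rest l
    ≡⟨ cong₂ _+_ (*-identityˡ (act M p (v zero) l)) (act-sum M p (v ∘ suc) l) ⟩
  act M p (v zero) l + ∑[ k < m ] (act M p (v (suc k)) l) ∎
  where
  rest : Vector _
  rest j = ∑[ k < m ] (v (suc k) j)

act-+P : (M : Matrix n) → ∀ p q v l → act M (p +P q) v l ≡ act M p v l + act M q v l
act-+P M []      q       v l = sym (+-identityˡ _)
act-+P M (a ∷ p) []      v l = sym (+-identityʳ _)
act-+P M (a ∷ p) (b ∷ q) v l = begin
  (a + b) * v l + (M · act M (p +P q) v) l
    ≡⟨ cong ((a + b) * v l +_) (·-cong M step l) ⟩
  (a + b) * v l + (M · (λ j → 1ℤ * act M p v j + act M q v j)) l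
    ≡⟨ cong ((a + b) * v l +_) (·-linear M 1ℤ (act M p v) (act M q v) l) ⟩
  (a + b) * v l + (1ℤ * (M · act M p v) l + (M · act M q v) l)
    ≡⟨ eq a b (v l) _ _ ⟩
  (a * v l + (M · act M p v) l) + (b * v l + (M · act M q v) l) ∎
  where
  step : act M (p +P q) v ≗ (λ j → 1ℤ * act M p v j + act M q v j)
  step j = trans (act-+P M p q v j) (cong (_+ act M q v j) (sym (*-identityˡ (act M p v j))))
  eq : ∀ a b x e f → (a + b) * x + (1ℤ * e + f) ≡ (a * x + e) + (b * x + f)
  eq = solve-∀

act-scaleP : (M : Matrix n) → ∀ a p v l → act M (scaleP a p) v l ≡ a * act M p v l
act-scaleP M a []      v l = sym (*-zeroʳ a)
act-scaleP M a (b ∷ p) v l = begin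
  a * b * v l + (M · act M (scaleP a p) v) l
    ≡⟨ cong (a * b * v l +_) (·-cong M (λ j → trans (act-scaleP M a p v j) (sym (+-identityʳ _))) l) ⟩
  a * b * v l + (M · (λ j → a * act M p v j + 0ℤ)) l
    ≡⟨ cong (a * b * v l +_) (·-linear M a (act M p v) (const 0ℤ) l) ⟩
  a * b * v l + (a * (M · act M p v) l + (M · const 0ℤ) l)
    ≡⟨ cong (λ z → a * b * v l + (a * (M · act M p v) l + z)) (·-zero M {const 0ℤ} (λ _ → refl) l) ⟩
  a * b * v l + (a * (M · act M p v) l + 0ℤ)
    ≡⟨ eq a b (v l) _ ⟩
  a * (b * v l + (M · act M p v) l) ∎
  where
  eq : ∀ a b x e → a * b * x + (a * e + 0ℤ) ≡ a * (b * x + e)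
  eq = solve-∀

act-*P : (M : Matrix n) → ∀ p q v l → act M (p *P q) v l ≡ act M p (act M q v) l
act-*P M []      q v l = refl
act-*P M (a ∷ p) q v l = begin
  act M (scaleP a q +P (0ℤ ∷ p *P q)) v l
    ≡⟨ act-+P M (scaleP a q) (0ℤ ∷ p *P q) v l ⟩
  act M (scaleP a q) v l + (0ℤ * v l + (M · act M (p *P q) v) l)
    ≡⟨ cong₂ _+_ (act-scaleP M a q v l) (trans (cong (_+ (M · act M (p *P q) v) l) (*-zeroˡ (v l))) (+-identityˡ _)) ⟩
  a * act M q v l + (M · act M (p *P q) v) l
    ≡⟨ cong (a * act M q v l +_) (·-cong M (act-*P M p q v) l) ⟩
  a * act M q v l + (M · act M p (act M q v)) l ∎

act-sumFin : (M : Matrix n) → ∀ m (f : Fin m → Poly) v l → act M (sumFin m f) v l ≡ ∑[ j < m ] (act M (f j) v l)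
act-sumFin M zero    f v l = refl
act-sumFin M (suc m) f v l = trans (act-+P M (f zero) (sumFin m (f ∘ suc)) v l) (cong (act M (f zero) v l +_) (act-sumFin M m (f ∘ suc) v l))

act-constP : (M : Matrix n) → ∀ a v l → act M (constP a) v l ≡ a * v l
act-constP M a v l = trans (cong (a * v l +_) (·-zero M {const 0ℤ} (λ _ → refl) l)) (+-identityʳ _)

act-X : (M : Matrix n) → ∀ v l → act M X v l ≡ (M · v) l
act-X M v l = begin
  0ℤ * v l + (M · act M (constP 1ℤ) v) l
    ≡⟨ cong₂ _+_ (*-zeroˡ (v l)) (·-cong M (λ j → trans (act-constP M 1ℤ v j) (*-identityˡ (v j))) l) ⟩
  0ℤ + (M · v) l ≡⟨ +-identityˡ _ ⟩
  (M · v) l ∎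

-- The characteristic matrix and Cayley-Hamilton

charEntry : Matrix n → Fin n → Fin n → Poly
charEntry M i j = (if ⌊ i ≟F j ⌋ then X else []) +P constP (- M i j)

-- For M = `adj G` this unfolds to `charPoly G`, so results on arbitrary matrices apply to graphs
-- without conversion.
charPolyOf : Matrix n → Poly
charPolyOf M = det _ (charEntry M)

charMatrix : Matrix n → ℤ → Matrix n
charMatrix M x i j = x * δ i j + - M i j

eval-charEntry : (M : Matrix n) → ∀ x i j → eval (charEntry M i j) x ≡ charMatrix M x i j
eval-charEntry M x i j = trans (eval-+P (if ⌊ i ≟F j ⌋ then X else []) (constP (- M i j)) x)
  (cong₂ _+_ diag (eval-constP (- M i j) x))
  where
  diag : eval (if ⌊ i ≟F j ⌋ then X else []) x ≡ x * δ i j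
  diag with i ≟F j
  ... | yes refl = trans (eval-X x) (sym (trans (cong (x *_) (δ-diag i)) (*-identityʳ x)))
  ... | no i≢j   = sym (trans (cong (x *_) (δ-off i≢j)) (*-zeroʳ x))

eval-charPolyOf : (M : Matrix n) → ∀ x → eval (charPolyOf M) x ≡ detℤ n (charMatrix M x)
eval-charPolyOf {n} M x = trans (eval-det n (charEntry M) x) (det-cong (eval-charEntry M x))

act-charEntry : (M : Matrix n) → ∀ i j v l → act M (charEntry M i j) v l ≡ δ i j * (M · v) l + - M i j * v l
act-charEntry M i j v l = trans (act-+P M (if ⌊ i ≟F j ⌋ then X else []) (constP (- M i j)) v l)
  (cong₂ _+_ diag (act-constP M (- M i j) v l))
  where
  diag : act M (if ⌊ i ≟F j ⌋ then X else []) v l ≡ δ i j * (M · v) l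
  diag with i ≟F j
  ... | yes refl = trans (act-X M v l) (sym (trans (cong (_* (M · v) l) (δ-diag i)) (*-identityˡ _)))
  ... | no i≢j   = sym (trans (cong (_* (M · v) l) (δ-off i≢j)) (*-zeroˡ ((M · v) l)))

-- The cofactors of X - M must be genuine polynomials, because Cayley-Hamilton substitutes M, not an
-- integer, for X.
adjugateP : Matrix n → Fin n → Fin n → Poly
adjugateP M i j = det _ (charEntry M [ i ≔ constP ∘ δ j ])

eval-adjugateP : (M : Matrix n) → ∀ x i j → eval (adjugateP M i j) x ≡ adjugate (charMatrix M x) i j
eval-adjugateP {n} M x i j = trans (eval-det n (charEntry M [ i ≔ constP ∘ δ j ]) x) (det-cong entry)
  where
  entry : (λ r c → eval ((charEntry M [ i ≔ constP ∘ δ j ]) r c) x) ≐ charMatrix M x [ i ≔ δ j ]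
  entry r c with r ≟F i
  ... | yes refl = begin
    eval ((charEntry M [ i ≔ constP ∘ δ j ]) i c) x ≡⟨ cong (λ f → eval (f c) x) (updateAt-updates i (charEntry M)) ⟩
    eval (constP (δ j c)) x                         ≡⟨ eval-constP (δ j c) x ⟩
    δ j c                                           ≡⟨ cong-app (updateAt-updates i (charMatrix M x)) c ⟨
    (charMatrix M x [ i ≔ δ j ]) i c                ∎
  ... | no r≢i = begin
    eval ((charEntry M [ i ≔ constP ∘ δ j ]) r c) x ≡⟨ cong (λ f → eval (f c) x) (updateAt-minimal r i (charEntry M) r≢i) ⟩
    eval (charEntry M r c) x                        ≡⟨ eval-charEntry M x r c ⟩
    charMatrix M x r c                              ≡⟨ cong-app (updateAt-minimal r i (charMatrix M x) r≢i) c ⟨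
    (charMatrix M x [ i ≔ δ j ]) r c                ∎

·-δ : (M : Matrix n) → ∀ k l → (M · δ k) l ≡ M l k
·-δ M k l = trans (sum-only k λ j j≢k → trans (cong (M l j *_) (δ-off (j≢k ∘ sym))) (*-zeroʳ (M l j)))
                  (trans (cong (M l k *_) (δ-diag k)) (*-identityʳ (M l k)))

-- Let x act as M: then Σₖ (x δₖⱼ − Mₖⱼ) eₖ = 0, and multiplying by the adjugate
-- of x − M leaves charPoly(x) eᵢ = 0.
cayley-hamilton : (M : Matrix n) → ∀ i l → act M (charPolyOf M) (δ i) l ≡ 0ℤ
cayley-hamilton {n} M i l = begin
  act M (charPolyOf M) (δ i) l
    ≡⟨ act-congˡ M (charPolyOf M) (Q i) (δ i) (eval-injective (charPolyOf M) (Q i) λ y → sym (evalQ-diag ℤ.+[1+ y ])) l ⟩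
  act M (Q i) (δ i) l
    -- For k ≠ i, `Q k` is the zero polynomial, by expansion with a repeated row. The single term
    -- can thus be spread over all k, which makes the sums interchangeable.
    ≡⟨ sum-only i (λ k k≢i → act-zero M (Q k) (δ k)
         (eval-injective (Q k) [] λ y → trans (evalQ ℤ.+[1+ y ] k) (adjugate-off (charMatrix M ℤ.+[1+ y ]) (k≢i ∘ sym))) l) ⟨
  ∑[ k < n ] (act M (Q k) (δ k) l)
    ≡⟨ sum-cong-≗ (λ k → trans (act-sumFin M n (λ j → B j *P C k j) (δ k) l)
         (sum-cong-≗ λ j → act-*P M (B j) (C k j) (δ k) l)) ⟩
  ∑[ k < n ] ∑[ j < n ] (act M (B j) (act M (C k j) (δ k)) l)
    -- With j outermost, the cofactor `B j` no longer depends on the inner index k and comes out of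
    -- the inner sum, which vanishes.
    ≡⟨ ∑-comm (λ k j → act M (B j) (act M (C k j) (δ k)) l) ⟩
  ∑[ j < n ] ∑[ k < n ] (act M (B j) (act M (C k j) (δ k)) l)
    ≡⟨ sum-cong-≗ (λ j → sym (act-sum M (B j) (λ k → act M (C k j) (δ k)) l)) ⟩
  ∑[ j < n ] (act M (B j) (λ l′ → ∑[ k < n ] (act M (C k j) (δ k) l′)) l)
    ≡⟨ sum-zero _ (λ j → act-0 M (B j) (column j) l) ⟩
  0ℤ ∎
  where
  B : Fin n → Poly
  B = adjugateP M i
  C : Fin n → Fin n → Poly
  C = charEntry M
  Q : Fin n → Poly
  Q k = sumFin n λ j → B j *P C k j
  evalQ : ∀ x k → eval (Q k) x ≡ ∑[ j < n ] (charMatrix M x k j * adjugate (charMatrix M x) i j)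
  evalQ x k = trans (eval-sumFin n (λ j → B j *P C k j) x) (sum-cong-≗ λ j →
    trans (eval-*P (B j) (C k j) x)
      (trans (cong₂ _*_ (eval-adjugateP M x i j) (eval-charEntry M x k j))
             (*-comm (adjugate (charMatrix M x) i j) (charMatrix M x k j))))
  evalQ-diag : ∀ x → eval (Q i) x ≡ eval (charPolyOf M) x
  evalQ-diag x = trans (evalQ x i) (trans (adjugate-diag (charMatrix M x) i) (sym (eval-charPolyOf M x)))
  column : ∀ j l′ → ∑[ k < n ] (act M (C k j) (δ k) l′) ≡ 0ℤ
  column j l′ = begin
    ∑[ k < n ] (act M (C k j) (δ k) l′)
      ≡⟨ sum-linear -1ℤ (λ k → trans (act-charEntry M k j (δ k) l′)
           (trans (cong (λ e → δ k j * e + - M k j * δ k l′) (·-δ M k l′)) (eq (δ k j) (M l′ k) (M k j) (δ k l′)))) ⟩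
    -1ℤ * ∑[ k < n ] (M k j * δ k l′) + ∑[ k < n ] (M l′ k * δ k j)
      ≡⟨ cong₂ (λ a b → -1ℤ * a + b) (sum-δʳ (λ k → M k j) l′) (sum-δʳ (M l′) j) ⟩
    -1ℤ * M l′ j + M l′ j
      ≡⟨ cancel (M l′ j) ⟩
    0ℤ ∎
    where
    eq : ∀ d m a e → d * m + - a * e ≡ -1ℤ * (a * e) + m * d
    eq = solve-∀
    cancel : ∀ m → -1ℤ * m + m ≡ 0ℤ
    cancel = solve-∀

-- Symmetric matrices

Symmetric : Matrix n → Set
Symmetric M = ∀ i j → M i j ≡ M j i

inner : Vector n → Vector n → ℤ
inner v w = ∑[ i < _ ] (v i * w i)

inner-comm : (v w : Vector n) → inner v w ≡ inner w v
inner-comm v w = sum-cong-≗ λ i → *-comm (v i) (w i)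

inner-zeroˡ : {v : Vector n} (w : Vector n) → v ≗ const 0ℤ → inner v w ≡ 0ℤ
inner-zeroˡ w v≗0 = sum-zero _ λ i → trans (cong (_* w i) (v≗0 i)) (*-zeroˡ (w i))

inner-linearˡ : (a : ℤ) (v w u : Vector n) → inner (λ i → a * v i + w i) u ≡ a * inner v u + inner w u
inner-linearˡ a v w u = sum-linear a λ i → eq a (v i) (w i) (u i)
  where
  eq : ∀ a x y z → (a * x + y) * z ≡ a * (x * z) + y * z
  eq = solve-∀

inner-linearʳ : (a : ℤ) (v w u : Vector n) → inner u (λ i → a * v i + w i) ≡ a * inner u v + inner u w
inner-linearʳ a v w u = trans (inner-comm u _) (trans (inner-linearˡ a v w u)
  (cong₂ (λ p q → a * p + q) (inner-comm v u) (inner-comm w u)))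

inner-δ : (i : Fin n) (v : Vector n) → inner (δ i) v ≡ v i
inner-δ i v = trans (sum-only i λ j j≢i → trans (cong (_* v j) (δ-off (j≢i ∘ sym))) (*-zeroˡ (v j)))
                    (trans (cong (_* v i) (δ-diag i)) (*-identityˡ (v i)))

·-selfAdjoint : (M : Matrix n) → Symmetric M → ∀ v w → inner (M · v) w ≡ inner v (M · w)
·-selfAdjoint {n} M M-sym v w = begin
  ∑[ i < n ] ((M · v) i * w i)
    ≡⟨ sum-cong-≗ (λ i → *-distribʳ-sum (w i) (λ j → M i j * v j)) ⟩
  ∑[ i < n ] ∑[ j < n ] (M i j * v j * w i)
    ≡⟨ ∑-comm (λ i j → M i j * v j * w i) ⟩
  ∑[ j < n ] ∑[ i < n ] (M i j * v j * w i)
    ≡⟨ sum-cong-≗ (λ j → trans (sum-cong-≗ λ i → trans (cong (λ m → m * v j * w i) (M-sym i j)) (eq (M j i) (v j) (w i)))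
         (sym (*-distribˡ-sum (v j) (λ i → M j i * w i)))) ⟩
  ∑[ j < n ] (v j * (M · w) j) ∎
  where
  eq : ∀ m x y → m * x * y ≡ x * (m * y)
  eq = solve-∀

0≤i*i : ∀ i → 0ℤ ℤ.≤ i * i
0≤i*i (ℤ.+ n)    = subst (0ℤ ℤ.≤_) (pos-* n n) (ℤ.+≤+ ℕ.z≤n)
0≤i*i ℤ.-[1+ n ] = ℤ.+≤+ ℕ.z≤n

sum-nonneg : (f : Vector n) → (∀ i → 0ℤ ℤ.≤ f i) → 0ℤ ℤ.≤ sum f
sum-nonneg {zero}  f f≥0 = ≤-refl
sum-nonneg {suc n} f f≥0 = +-mono-≤ (f≥0 zero) (sum-nonneg (f ∘ suc) (f≥0 ∘ suc))

+-nonneg-zeroˡ : ∀ {a b} → 0ℤ ℤ.≤ a → 0ℤ ℤ.≤ b → a + b ≡ 0ℤ → a ≡ 0ℤ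
+-nonneg-zeroˡ {a} {b} a≥0 b≥0 eq = ≤-antisym
  (subst (ℤ._≤ 0ℤ) (+-identityʳ a) (subst (a + 0ℤ ℤ.≤_) eq (+-monoʳ-≤ a b≥0))) a≥0

sum-nonneg-zero : (f : Vector n) → (∀ i → 0ℤ ℤ.≤ f i) → sum f ≡ 0ℤ → f ≗ const 0ℤ
sum-nonneg-zero f f≥0 eq zero    = +-nonneg-zeroˡ (f≥0 zero) (sum-nonneg (f ∘ suc) (f≥0 ∘ suc)) eq
sum-nonneg-zero f f≥0 eq (suc i) = sum-nonneg-zero (f ∘ suc) (f≥0 ∘ suc)
  (+-nonneg-zeroˡ (sum-nonneg (f ∘ suc) (f≥0 ∘ suc)) (f≥0 zero) (trans (+-comm (sum (f ∘ suc)) (f zero)) eq)) i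

inner-nonneg : (v : Vector n) → 0ℤ ℤ.≤ inner v v
inner-nonneg v = sum-nonneg (λ i → v i * v i) (λ i → 0≤i*i (v i))

inner-definite : (v : Vector n) → inner v v ≡ 0ℤ → v ≗ const 0ℤ
inner-definite v eq i with i*j≡0⇒i≡0∨j≡0 (v i) (sum-nonneg-zero (λ i → v i * v i) (λ i → 0≤i*i (v i)) eq i)
... | inj₁ p = p
... | inj₂ p = p

-- The operator A² - k, that is -N. The scalar term stands first to fit the shape `a * v + w` of the
-- linearity lemmas.
shiftedSquare : Matrix n → ℕ → Vector n → Vector n
shiftedSquare A k v l = - (ℤ.+ k) * v l + (A · A · v) l

module _ (A : Matrix n) (A-sym : Symmetric A) (k : ℕ) where

  private
    S : Vector n → Vector n
    S = shiftedSquare A k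

  act-X²-k : ∀ v → act A (X²-k k) v ≗ S v
  act-X²-k v l = begin
    act A (X *P X +P constP (- (ℤ.+ k))) v l
      ≡⟨ act-+P A (X *P X) (constP (- (ℤ.+ k))) v l ⟩
    act A (X *P X) v l + act A (constP (- (ℤ.+ k))) v l
      ≡⟨ cong₂ _+_ (trans (act-*P A X X v l) (trans (act-X A (act A X v) l) (·-cong A (act-X A v) l))) (act-constP A (- (ℤ.+ k)) v l) ⟩
    (A · A · v) l + - (ℤ.+ k) * v l
      ≡⟨ +-comm ((A · A · v) l) (- (ℤ.+ k) * v l) ⟩
    S v l ∎

  shiftedSquare-zero : ∀ {v} → v ≗ const 0ℤ → S v ≗ const 0ℤ
  shiftedSquare-zero v≗0 l = cong₂ _+_ (trans (cong (- (ℤ.+ k) *_) (v≗0 l)) (*-zeroʳ (- (ℤ.+ k))))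
                                       (·-zero A (·-zero A v≗0) l)

  shiftedSquare-selfAdjoint : ∀ v w → inner (S v) w ≡ inner v (S w)
  shiftedSquare-selfAdjoint v w = begin
    inner (S v) w
      ≡⟨ inner-linearˡ (- (ℤ.+ k)) v (A · A · v) w ⟩
    - (ℤ.+ k) * inner v w + inner (A · A · v) w
      ≡⟨ cong (- (ℤ.+ k) * inner v w +_) (trans (·-selfAdjoint A A-sym (A · v) w) (·-selfAdjoint A A-sym v (A · w))) ⟩
    - (ℤ.+ k) * inner v w + inner v (A · A · w)
      ≡⟨ inner-linearʳ (- (ℤ.+ k)) w (A · A · w) v ⟨
    inner v (S w) ∎

  -- A self-adjoint operator has no nilpotent part: ⟨Su , Su⟩ = ⟨u , S²u⟩.
  shiftedSquare-reduced : ∀ m w → act A (X²-k k ^P m) w ≗ const 0ℤ → S w ≗ const 0ℤ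
  shiftedSquare-reduced zero w eq = shiftedSquare-zero λ l →
    trans (sym (trans (act-constP A 1ℤ w l) (*-identityˡ (w l)))) (eq l)
  shiftedSquare-reduced (suc zero) w eq l = begin
    S w l                                ≡⟨ act-X²-k w l ⟨
    act A (X²-k k) w l                   ≡⟨ act-congʳ A (X²-k k) (λ j → trans (act-constP A 1ℤ w j) (*-identityˡ (w j))) l ⟨
    act A (X²-k k) (act A (constP 1ℤ) w) l ≡⟨ act-*P A (X²-k k) (constP 1ℤ) w l ⟨
    act A (X²-k k ^P 1) w l              ≡⟨ eq l ⟩
    0ℤ                                   ∎
  shiftedSquare-reduced (suc (suc m)) w eq = shiftedSquare-reduced (suc m) w λ l → begin
    act A (X²-k k ^P suc m) w l ≡⟨ power m l ⟩
    S u l                       ≡⟨ inner-definite (S u) (trans (shiftedSquare-selfAdjoint u (S u)) (trans (inner-comm u (S (S u))) (inner-zeroˡ u SSu≗0))) l ⟩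
    0ℤ                          ∎
    where
    u : Vector n
    u = act A (X²-k k ^P m) w
    power : ∀ m → act A (X²-k k ^P suc m) w ≗ S (act A (X²-k k ^P m) w)
    power m l = trans (act-*P A (X²-k k) (X²-k k ^P m) w l) (act-X²-k (act A (X²-k k ^P m) w) l)
    SSu≗0 : S (S u) ≗ const 0ℤ
    SSu≗0 l = begin
      S (S u) l                                 ≡⟨ act-X²-k (S u) l ⟨
      act A (X²-k k) (S u) l                    ≡⟨ act-congʳ A (X²-k k) (power m) l ⟨
      act A (X²-k k) (act A (X²-k k ^P suc m) w) l ≡⟨ act-*P A (X²-k k) (X²-k k ^P suc m) w l ⟨
      act A (X²-k k ^P suc (suc m)) w l         ≡⟨ eq l ⟩
      0ℤ                                        ∎

-- First-order expansion of the determinant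

-- The product rule, applied to the first-row expansion, yields one determinant per row of M
-- replaced by that of N. The rest is recorded only as divisible by x², which is all that a
-- multiplicity argument asks for.
det-perturb : (M N : Matrix n) (x : ℤ) → ∃ λ q →
  detℤ n (λ i j → M i j + x * N i j) ≡ detℤ n M + x * ∑[ i < n ] (detℤ n (M [ i ≔ N i ])) + x * x * q
det-perturb {zero}  M N x = 0ℤ , eq x
  where
  eq : ∀ x → 1ℤ ≡ 1ℤ + x * 0ℤ + x * x * 0ℤ
  eq = solve-∀
det-perturb {suc n} M N x = sum r , (begin
  sum (λ j → s j * ((M zero j + x * N zero j) * detℤ n (minor (λ i j → M i j + x * N i j) j)))
    ≡⟨ sum-linear x expand ⟩
  x * sum f + sum (λ j → x * x * r j + g j)
    ≡⟨ cong (x * sum f +_) (sum-linear (x * x) {r} {g} λ _ → refl) ⟩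
  x * sum f + (x * x * sum r + sum g)
    ≡⟨ cong (λ e → x * e + (x * x * sum r + sum g)) derivative ⟩
  x * (detℤ (suc n) (M [ zero ≔ N zero ]) + ∑[ i < n ] (detℤ (suc n) (M [ suc i ≔ N (suc i) ]))) + (x * x * sum r + sum g)
    ≡⟨ collect x _ (sum r) (sum g) ⟩
  detℤ (suc n) M + x * ∑[ i < suc n ] (detℤ (suc n) (M [ i ≔ N i ])) + x * x * sum r ∎)
  where
  s : Fin (suc n) → ℤ
  s j = altSign (toℕ j)
  IH : ∀ j → ∃ λ q → detℤ n (minor (λ i j → M i j + x * N i j) j) ≡
       detℤ n (minor M j) + x * ∑[ i < n ] (detℤ n (minor M j [ i ≔ minor N j i ])) + x * x * q
  IH j = det-perturb (minor M j) (minor N j) x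
  D E q f g r : Fin (suc n) → ℤ
  D j = detℤ n (minor M j)
  E j = ∑[ i < n ] (detℤ n (minor M j [ i ≔ minor N j i ]))
  q j = proj₁ (IH j)
  f j = 1ℤ * (s j * (N zero j * D j)) + s j * (M zero j * E j)
  g j = s j * (M zero j * D j)
  -- Everything of order two or more in (a + xb)(d + xe + x²q), divided by x².
  r j = s j * (M zero j * q j + N zero j * E j + x * (N zero j * q j))
  expand : ∀ j → s j * ((M zero j + x * N zero j) * detℤ n (minor (λ i j → M i j + x * N i j) j)) ≡ x * f j + (x * x * r j + g j)
  expand j = trans (cong (λ d → s j * ((M zero j + x * N zero j) * d)) (proj₂ (IH j)))
                   (eq (s j) (M zero j) (N zero j) x (D j) (E j) (q j))
    where
    eq : ∀ s a b x d e q → s * ((a + x * b) * (d + x * e + x * x * q)) ≡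
         x * (1ℤ * (s * (b * d)) + s * (a * e)) + (x * x * (s * (a * q + b * e + x * (b * q))) + s * (a * d))
    eq = solve-∀
  collect : ∀ x e r g → x * e + (x * x * r + g) ≡ g + x * e + x * x * r
  collect = solve-∀
  derivative : sum f ≡ detℤ (suc n) (M [ zero ≔ N zero ]) + ∑[ i < n ] (detℤ (suc n) (M [ suc i ≔ N (suc i) ]))
  derivative = begin
    sum f
      ≡⟨ sum-linear 1ℤ {λ j → s j * (N zero j * D j)} {λ j → s j * (M zero j * E j)} (λ _ → refl) ⟩
    1ℤ * detℤ (suc n) (M [ zero ≔ N zero ]) + ∑[ j < suc n ] (s j * (M zero j * E j))
      ≡⟨ cong₂ _+_ (*-identityˡ (detℤ (suc n) (M [ zero ≔ N zero ]))) (sum-cong-≗ row) ⟩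
    detℤ (suc n) (M [ zero ≔ N zero ]) + ∑[ j < suc n ] ∑[ i < n ] (t j i)
      ≡⟨ cong (detℤ (suc n) (M [ zero ≔ N zero ]) +_) (∑-comm t) ⟩
    detℤ (suc n) (M [ zero ≔ N zero ]) + ∑[ i < n ] (detℤ (suc n) (M [ suc i ≔ N (suc i) ])) ∎
    where
    t : Fin (suc n) → Fin n → ℤ
    t j i = s j * (M zero j * detℤ n (minor (M [ suc i ≔ N (suc i) ]) j))
    row : ∀ j → s j * (M zero j * E j) ≡ ∑[ i < n ] (t j i)
    row j = begin
      s j * (M zero j * E j)
        ≡⟨ *-assoc (s j) (M zero j) (E j) ⟨
      s j * M zero j * E j
        ≡⟨ *-distribˡ-sum (s j * M zero j) (λ i → detℤ n (minor M j [ i ≔ minor N j i ])) ⟩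
      ∑[ i < n ] (s j * M zero j * detℤ n (minor M j [ i ≔ minor N j i ]))
        ≡⟨ sum-cong-≗ (λ i → trans (*-assoc (s j) (M zero j) _)
             (cong (λ d → s j * (M zero j * d)) (sym (det-cong (minor-update M i (N (suc i)) j))))) ⟩
      ∑[ i < n ] (t j i) ∎

-- The multiplicity of the root 0

charMatrix-0 : (A : Matrix n) (v : Vector n) → ∀ l → (charMatrix A 0ℤ · v) l ≡ -1ℤ * (A · v) l
charMatrix-0 A v l = trans (sum-cong-≗ λ j → eq (δ l j) (A l j) (v j)) (sym (*-distribˡ-sum -1ℤ (λ j → A l j * v j)))
  where
  eq : ∀ d a v → (0ℤ * d + - a) * v ≡ -1ℤ * (a * v)
  eq = solve-∀

-- The linear coefficient of det(x - A) is the trace of the adjugate of -A. A root 0 of multiplicity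
-- at least two is expressed by divisibility of every value by x².
charPolyOf-second-order : (A : Matrix n) → detℤ n (charMatrix A 0ℤ) ≡ 0ℤ → (∀ i → adjugate (charMatrix A 0ℤ) i i ≡ 0ℤ) →
                          ∀ x → ∃ λ q → eval (charPolyOf A) x ≡ x * x * q
charPolyOf-second-order {n} A det≡0 adj≡0 x = q , (begin
  eval (charPolyOf A) x       ≡⟨ eval-charPolyOf A x ⟩
  detℤ n (charMatrix A x)     ≡⟨ det-cong (λ i j → shift x (δ i j) (A i j)) ⟩
  detℤ n (λ i j → charMatrix A 0ℤ i j + x * δ i j) ≡⟨ proj₂ expansion ⟩
  detℤ n (charMatrix A 0ℤ) + x * ∑[ i < n ] (adjugate (charMatrix A 0ℤ) i i) + x * x * q
    ≡⟨ cong₂ (λ a b → a + x * b + x * x * q) det≡0 (sum-zero _ adj≡0) ⟩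
  0ℤ + x * 0ℤ + x * x * q     ≡⟨ tidy x q ⟩
  x * x * q                   ∎)
  where
  expansion = det-perturb (charMatrix A 0ℤ) δ x
  q = proj₁ expansion
  shift : ∀ x d a → x * d + - a ≡ (0ℤ * d + - a) + x * d
  shift = solve-∀
  tidy : ∀ x q → 0ℤ + x * 0ℤ + x * x * q ≡ x * x * q
  tidy = solve-∀

-- Congruence to 1 modulo x is closed under products; it is written with an explicit quotient.
power-≡1 : ∀ x y m → ∃ λ r → (1ℤ + x * y) ℤ.^ m ≡ 1ℤ + x * r
power-≡1 x y zero    = 0ℤ , eq x
  where
  eq : ∀ x → 1ℤ ≡ 1ℤ + x * 0ℤ
  eq = solve-∀
power-≡1 x y (suc m) with power-≡1 x y m
... | r , eq = y + r + x * (y * r) , trans (cong ((1ℤ + x * y) *_) eq) (expand x y r)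
  where
  expand : ∀ x y r → (1ℤ + x * y) * (1ℤ + x * r) ≡ 1ℤ + x * (y + r + x * (y * r))
  expand = solve-∀

eval-X*[X²-k]^m : ∀ k m x → eval (X *P (X²-k k ^P m)) x ≡ x * (x * x + - (ℤ.+ k)) ℤ.^ m
eval-X*[X²-k]^m k m x = trans (eval-*P X (X²-k k ^P m) x)
  (cong₂ _*_ (eval-X x) (trans (eval-^P (X²-k k) m x) (cong (ℤ._^ m) (eval-X²-k k x))))

-- Evaluate at x = k + 1, where x² − k ≡ 1 modulo x.
simple-zero : ∀ k m → ¬ (∀ x → ∃ λ q → eval (X *P (X²-k (suc k) ^P m)) x ≡ x * x * q)
simple-zero k m second-order with second-order x₀ | power-≡1 x₀ (ℤ.+ suc k) m
  where x₀ = ℤ.+ suc (suc k)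
-- Cancelling one factor x from the two forms of the value leaves 1 = x(q - r). This is absurd
-- because x ≥ 2, which is where the positive parameter `suc k` enters.
... | q , eq | r , pow = contradiction (ℕ.m*n≡1⇒m≡1 (suc (suc k)) ℤ.∣ q + - r ∣ (begin
  suc (suc k) ℕ.* ℤ.∣ q + - r ∣ ≡⟨ abs-* x (q + - r) ⟨
  ℤ.∣ x * (q + - r) ∣           ≡⟨ cong ℤ.∣_∣ unit ⟨
  1                             ∎)) λ ()
  where
  x = ℤ.+ suc (suc k)
  K = ℤ.+ suc k
  cancelled : 1ℤ + x * r ≡ x * q
  cancelled = *-cancelˡ-≡ x (1ℤ + x * r) (x * q) (begin
    x * (1ℤ + x * r)            ≡⟨ cong (x *_) pow ⟨
    x * (1ℤ + x * K) ℤ.^ m      ≡⟨ cong (λ b → x * b ℤ.^ m) (base K) ⟩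
    x * (x * x + - K) ℤ.^ m     ≡⟨ eval-X*[X²-k]^m (suc k) m x ⟨
    eval (X *P (X²-k (suc k) ^P m)) x ≡⟨ eq ⟩
    x * x * q                   ≡⟨ *-assoc x x q ⟩
    x * (x * q)                 ∎)
    where
    base : ∀ K → 1ℤ + (1ℤ + K) * K ≡ (1ℤ + K) * (1ℤ + K) + - K
    base = solve-∀
  unit : 1ℤ ≡ x * (q + - r)
  unit = begin
    1ℤ                        ≡⟨ isolate x r ⟩
    (1ℤ + x * r) + - (x * r)  ≡⟨ cong (_+ - (x * r)) cancelled ⟩
    x * q + - (x * r)         ≡⟨ factor x q r ⟩
    x * (q + - r)             ∎
    where
    isolate : ∀ x r → 1ℤ ≡ (1ℤ + x * r) + - (x * r)
    isolate = solve-∀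
    factor : ∀ x q r → x * q + - (x * r) ≡ x * (q + - r)
    factor = solve-∀

-- The border vector and the extended graph

-- Nonzero entries are ±1, so each contributes 1 to the sum of squares. By symmetry that sum is a
-- diagonal entry of A².
degree-squares : (G : SignedGraph n) (i : Fin n) → ℤ.+ degree G i ≡ ∑[ j < n ] (adj G i j * adj G i j)
degree-squares {n} G i = go n id
  where
  go : ∀ m (f : Fin m → Fin n) →
       ℤ.+ length (filter (λ j → ¬? (adj G i j ≟ 0ℤ)) (tabulate f)) ≡ ∑[ j < m ] (adj G i (f j) * adj G i (f j))
  go zero    f = refl
  go (suc m) f with adj G i (f zero) ≟ 0ℤ
  ... | yes a≡0 = begin
    ℤ.+ length (filter (λ j → ¬? (adj G i j ≟ 0ℤ)) (tabulate (f ∘ suc))) ≡⟨ go m (f ∘ suc) ⟩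
    rest                                                                 ≡⟨ +-identityˡ rest ⟨
    0ℤ + rest                                                            ≡⟨ cong (λ a → a * a + rest) a≡0 ⟨
    adj G i (f zero) * adj G i (f zero) + rest                           ∎
    where rest = ∑[ j < m ] (adj G i (f (suc j)) * adj G i (f (suc j)))
  ... | no a≢0 = cong₂ _+_ (sym (unit (entries G i (f zero)))) (go m (f ∘ suc))
    where
    unit : (adj G i (f zero) ≡ 0ℤ) ⊎ ((adj G i (f zero) ≡ 1ℤ) ⊎ (adj G i (f zero) ≡ -1ℤ)) →
           adj G i (f zero) * adj G i (f zero) ≡ 1ℤ
    unit (inj₁ a≡0)        = contradiction a≡0 a≢0
    unit (inj₂ (inj₁ a≡1)) = cong (λ a → a * a) a≡1
    unit (inj₂ (inj₂ a≡-1)) = cong (λ a → a * a) a≡-1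

square≤1 : ∀ z → z * z ℤ.≤ 1ℤ → (z ≡ 0ℤ) ⊎ ((z ≡ 1ℤ) ⊎ (z ≡ -1ℤ))
square≤1 (ℤ.+ 0)             _ = inj₁ refl
square≤1 (ℤ.+ 1)             _ = inj₂ (inj₁ refl)
square≤1 (ℤ.+ suc (suc n))   (ℤ.+≤+ (ℕ.s≤s ()))
square≤1 ℤ.-[1+ 0 ]          _ = inj₂ (inj₂ refl)
square≤1 ℤ.-[1+ suc n ]      (ℤ.+≤+ (ℕ.s≤s ()))

-- The first condition makes the bordered matrix a signed graph; the other two are what clears its
-- first row in `bordered-det`.
BorderVector : SignedGraph n → ℕ → Vector n → Set
BorderVector G k u = (∀ i → (u i ≡ 0ℤ) ⊎ ((u i ≡ 1ℤ) ⊎ (u i ≡ -1ℤ))) × (adj G · u ≗ const 0ℤ) × (inner u u ≡ ℤ.+ k)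

-- The degree parameter of the paper is suc k here, and s i = −(suc k − A²)eᵢ.
module Border (k m : ℕ) (G : SignedGraph n)
              (char : charPoly G ≈P (X *P (X²-k (suc k) ^P m)))
              (deg : ∀ i → (degree G i ≡ suc k) ⊎ (degree G i ≡ k)) where

  private
    A : Matrix n
    A = adj G
    K : ℤ
    K = ℤ.+ suc k
    S : Vector n → Vector n
    S = shiftedSquare A (suc k)
    s : Fin n → Vector n
    s i = S (δ i)

  A-kills-s : ∀ i → A · s i ≗ const 0ℤ
  A-kills-s i l = begin
    (A · s i) l
      -- Linearity is all it takes to commute A with A² - K.
      ≡⟨ ·-linear A (- K) (δ i) (A · A · δ i) l ⟩
    S (A · δ i) l
      ≡⟨ shiftedSquare-reduced A (symmetric G) (suc k) m (A · δ i) power l ⟩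
    0ℤ ∎
    where
    Q = X²-k (suc k) ^P m
    -- X is moved to the right because the right factor acts first: `Q` must act on A eᵢ for
    -- `shiftedSquare-reduced` to apply.
    Q*X : (Q *P X) ≈P charPolyOf A
    Q*X = eval-injective (Q *P X) (charPolyOf A) λ y → let x = ℤ.+[1+ y ] in
      trans (eval-*P Q X x) (trans (*-comm (eval Q x) (eval X x))
        (trans (sym (eval-*P X Q x)) (sym (eval-cong (charPolyOf A) (X *P Q) x char))))
    power : act A Q (A · δ i) ≗ const 0ℤ
    power j = begin
      act A Q (A · δ i) j       ≡⟨ act-congʳ A Q (act-X A (δ i)) j ⟨
      act A Q (act A X (δ i)) j ≡⟨ act-*P A Q X (δ i) j ⟨
      act A (Q *P X) (δ i) j    ≡⟨ act-congˡ A (Q *P X) (charPolyOf A) (δ i) Q*X j ⟩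
      act A (charPolyOf A) (δ i) j ≡⟨ cayley-hamilton A i j ⟩
      0ℤ                        ∎

  S-kernel : ∀ {v} → A · v ≗ const 0ℤ → ∀ l → S v l ≡ - K * v l
  S-kernel {v} Av≗0 l = trans (cong (- K * v l +_) (·-zero A Av≗0 l)) (+-identityʳ (- K * v l))

  -- Self-adjointness turns the left side into an entry of S², and S² = -K S because A kills the
  -- image of S.
  gram : ∀ i j → inner (s i) (s j) ≡ - K * s j i
  gram i j = trans (shiftedSquare-selfAdjoint A (symmetric G) (suc k) (δ i) (s j))
    (trans (inner-δ i (S (s j))) (S-kernel (A-kills-s j) i))

  s-diag : ∀ i → s i i ≡ - K + ℤ.+ degree G i
  s-diag i = cong₂ _+_ (trans (cong (- K *_) (δ-diag i)) (*-identityʳ (- K)))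
    (trans (sum-cong-≗ λ j → cong (A i j *_) (trans (·-δ A i j) (symmetric G j i))) (sym (degree-squares G i)))

  s-diag-values : ∀ i → (s i i ≡ 0ℤ) ⊎ (s i i ≡ -1ℤ)
  s-diag-values i with deg i
  ... | inj₁ d = inj₁ (trans (s-diag i) (trans (cong (λ e → - K + ℤ.+ e) d) (+-inverseˡ K)))
  ... | inj₂ d = inj₂ (trans (s-diag i) (trans (cong (λ e → - K + ℤ.+ e) d) (eq (ℤ.+ k))))
    where
    eq : ∀ z → - (1ℤ + z) + z ≡ -1ℤ
    eq = solve-∀

  s-nonzero : ¬ (∀ i → s i i ≡ 0ℤ)
  s-nonzero diag≡0 = simple-zero k m λ x → let (q , eq) = charPolyOf-second-order A det≡0 adj≡0 x in
    q , trans (sym (eval-cong (charPolyOf A) (X *P (X²-k (suc k) ^P m)) x char)) eq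
    where
    s≗0 : ∀ i → s i ≗ const 0ℤ
    -- By `gram`, ‖sᵢ‖² is -K times the i-th diagonal entry, so a zero diagonal kills whole columns.
    s≗0 i = inner-definite (s i) (trans (gram i i) (trans (cong (- K *_) (diag≡0 i)) (*-zeroʳ (- K))))
    M₀ : Matrix n
    M₀ = charMatrix A 0ℤ
    det≡0 : detℤ n M₀ ≡ 0ℤ
    det≡0 = trans (sym (eval-charPolyOf A 0ℤ)) (trans (eval-cong (charPolyOf A) (X *P (X²-k (suc k) ^P m)) 0ℤ char)
      (trans (eval-X*[X²-k]^m (suc k) m 0ℤ) (*-zeroˡ ((0ℤ * 0ℤ + - K) ℤ.^ m))))
    module _ (i : Fin n) where
      -- A vector of cofactors of the singular matrix -A lies in the kernel of A, where S acts as
      -- -K. As S = 0 and K ≠ 0, it vanishes.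
      w : Vector n
      w = adjugate M₀ i
      M₀w≗0 : M₀ · w ≗ const 0ℤ
      M₀w≗0 l with i ≟F l
      ... | yes refl = trans (adjugate-diag M₀ i) det≡0
      ... | no i≢l   = adjugate-off M₀ i≢l
      Aw≗0 : A · w ≗ const 0ℤ
      Aw≗0 l = *-cancelˡ-≡ -1ℤ ((A · w) l) 0ℤ (trans (sym (charMatrix-0 A w l)) (M₀w≗0 l))
      Sw≗0 : S w ≗ const 0ℤ
      Sw≗0 l = begin
        S w l           ≡⟨ inner-δ l (S w) ⟨
        inner (δ l) (S w) ≡⟨ shiftedSquare-selfAdjoint A (symmetric G) (suc k) (δ l) w ⟨
        inner (s l) w   ≡⟨ inner-zeroˡ w (s≗0 l) ⟩
        0ℤ              ∎
      w≗0 : w ≗ const 0ℤ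
      w≗0 l = *-cancelˡ-≡ (- K) (w l) 0ℤ
        (trans (sym (S-kernel Aw≗0 l)) (trans (Sw≗0 l) (sym (*-zeroʳ (- K)))))
    adj≡0 : ∀ i → adjugate M₀ i i ≡ 0ℤ
    adj≡0 i = w≗0 i i

  -- Cauchy–Schwarz, from ‖ s i + uᵢ u ‖² ≥ 0.
  column-bound : ∀ i₀ → s i₀ i₀ ≡ -1ℤ → ∀ i → s i₀ i * s i₀ i ℤ.≤ - s i i
  column-bound i₀ s≡-1 i = *-cancelˡ-≤-pos _ _ K (0≤i-j⇒j≤i (subst (0ℤ ℤ.≤_) norm (inner-nonneg v)))
    where
    u v : Vector n
    u = s i₀
    -- Since ⟨sᵢ, u⟩ = -K uᵢ and ‖u‖² = K, this is sᵢ minus its projection onto u.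
    v j = u i * u j + s i j
    norm : inner v v ≡ K * (- s i i) ℤ.- K * (u i * u i)
    norm = begin
      inner v v
        ≡⟨ inner-linearˡ (u i) u (s i) v ⟩
      u i * inner u v + inner (s i) v
        ≡⟨ cong₂ (λ p q → u i * p + q) (inner-linearʳ (u i) u (s i) u) (inner-linearʳ (u i) u (s i) (s i)) ⟩
      u i * (u i * inner u u + inner u (s i)) + (u i * inner (s i) u + inner (s i) (s i))
        ≡⟨ cong (λ p → u i * (u i * inner u u + p) + (u i * inner (s i) u + inner (s i) (s i))) (inner-comm u (s i)) ⟩
      u i * (u i * inner u u + inner (s i) u) + (u i * inner (s i) u + inner (s i) (s i))
        ≡⟨ cong₂ (λ p q → u i * (u i * p + q) + (u i * q + inner (s i) (s i)))
             (trans (gram i₀ i₀) (cong (- K *_) s≡-1)) (gram i i₀) ⟩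
      u i * (u i * (- K * -1ℤ) + - K * u i) + (u i * (- K * u i) + inner (s i) (s i))
        ≡⟨ cong (λ p → u i * (u i * (- K * -1ℤ) + - K * u i) + (u i * (- K * u i) + p)) (gram i i) ⟩
      u i * (u i * (- K * -1ℤ) + - K * u i) + (u i * (- K * u i) + - K * s i i)
        ≡⟨ eq K (u i) (s i i) ⟩
      K * (- s i i) ℤ.- K * (u i * u i) ∎
      where
      eq : ∀ K u t → u * (u * (- K * -1ℤ) + - K * u) + (u * (- K * u) + - K * t) ≡ K * (- t) + - (K * (u * u))
      eq = solve-∀

  border : ∃ (BorderVector G (suc k))
  -- The index set is finite and equality decidable, so the negative statement `s-nonzero` yields an
  -- actual column.
  border with any? (λ i → s i i ≟ -1ℤ)
  ... | yes (i₀ , s≡-1) = s i₀ ,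
    (λ i → square≤1 (s i₀ i) (≤-trans (column-bound i₀ s≡-1 i) (bound i))) ,
    A-kills-s i₀ ,
    trans (gram i₀ i₀) (trans (cong (- K *_) s≡-1) (eq K))
    where
    eq : ∀ K → - K * -1ℤ ≡ K
    eq = solve-∀
    bound : ∀ i → - s i i ℤ.≤ 1ℤ
    bound i with s-diag-values i
    ... | inj₁ e = subst (λ z → - z ℤ.≤ 1ℤ) (sym e) (ℤ.+≤+ ℕ.z≤n)
    ... | inj₂ e = subst (λ z → - z ℤ.≤ 1ℤ) (sym e) ≤-refl
  ... | no none = contradiction diag≡0 s-nonzero
    where
    diag≡0 : ∀ i → s i i ≡ 0ℤ
    diag≡0 i with s-diag-values i
    ... | inj₁ e = e
    ... | inj₂ e = contradiction (i , e) none

-- The new vertex gets index zero: `punchIn zero` is `suc`, so deleting it returns G by computation,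
-- and determinants expand along its row.
bordered : (G : SignedGraph n) (u : Vector n) → (∀ i → (u i ≡ 0ℤ) ⊎ ((u i ≡ 1ℤ) ⊎ (u i ≡ -1ℤ))) → SignedGraph (suc n)
bordered {n} G u u-entries = record
  { adj = A′ ; entries = A′-entries ; symmetric = A′-symmetric ; loopless = A′-loopless }
  where
  A′ : Matrix (suc n)
  A′ zero    zero    = 0ℤ
  A′ zero    (suc j) = u j
  A′ (suc i) zero    = u i
  A′ (suc i) (suc j) = adj G i j
  A′-entries : ∀ i j → (A′ i j ≡ 0ℤ) ⊎ ((A′ i j ≡ 1ℤ) ⊎ (A′ i j ≡ -1ℤ))
  A′-entries zero    zero    = inj₁ refl
  A′-entries zero    (suc j) = u-entries j
  A′-entries (suc i) zero    = u-entries i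
  A′-entries (suc i) (suc j) = entries G i j
  A′-symmetric : Symmetric A′
  A′-symmetric zero    zero    = refl
  A′-symmetric zero    (suc j) = refl
  A′-symmetric (suc i) zero    = refl
  A′-symmetric (suc i) (suc j) = symmetric G i j
  A′-loopless : ∀ i → A′ i i ≡ 0ℤ
  A′-loopless zero    = refl
  A′-loopless (suc i) = loopless G i

-- Adding Σ uⱼ · row j to x · row 0 of x − H leaves (x² − k , 0 , … , 0) in row 0.
bordered-det : (k : ℕ) (G : SignedGraph n) (u : Vector n) (b : BorderVector G k u) (x : ℤ) →
  x * detℤ (suc n) (charMatrix (adj (bordered G u (proj₁ b))) x) ≡ (x * x + - (ℤ.+ k)) * detℤ n (charMatrix (adj G) x)
bordered-det {n} k G u (u-entries , Au≗0 , u² ) x = begin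
  x * detℤ (suc n) C
    ≡⟨ +-identityʳ (x * detℤ (suc n) C) ⟨
  x * detℤ (suc n) C + 0ℤ
    ≡⟨ cong₂ (λ a b → x * a + b) (det-cong same) combination ⟨
  x * detℤ (suc n) (C [ zero ≔ C zero ]) + detℤ (suc n) (C [ zero ≔ rows ])
    ≡⟨ det-linear C zero x (C zero) rows ⟨
  detℤ (suc n) (C [ zero ≔ (λ c → x * C zero c + rows c) ])
    -- Only the corner entry survives, and its minor is x - A by computation.
    ≡⟨ cong₂ _+_ first (sum-zero _ λ j → trans (cong (λ z → altSign (suc (toℕ j)) * (z * detℤ n (minor C (suc j)))) (tail-zero j))
         (kill (altSign (suc (toℕ j))) (detℤ n (minor C (suc j))))) ⟩
  (x * x + - (ℤ.+ k)) * detℤ n (charMatrix (adj G) x) + 0ℤ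
    ≡⟨ +-identityʳ _ ⟩
  (x * x + - (ℤ.+ k)) * detℤ n (charMatrix (adj G) x) ∎
  where
  C : Matrix (suc n)
  C = charMatrix (adj (bordered G u u-entries)) x
  rows : Vector (suc n)
  rows c = ∑[ j < n ] (u j * C (suc j) c)
  kill : ∀ s d → s * (0ℤ * d) ≡ 0ℤ
  kill = solve-∀
  same : C [ zero ≔ C zero ] ≐ C
  same zero    c = refl
  same (suc r) c = refl
  combination : detℤ (suc n) (C [ zero ≔ rows ]) ≡ 0ℤ
  combination = trans (det-sum C zero u (C ∘ suc)) (sum-zero _ λ j →
    trans (cong (u j *_) (det-alternating (C [ zero ≔ C (suc j) ]) {zero} {suc j} (λ ()) λ c → refl)) (*-zeroʳ (u j)))
  head-value : x * C zero zero + rows zero ≡ x * x + - (ℤ.+ k)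
  head-value = begin
    x * (x * 1ℤ + - 0ℤ) + ∑[ j < n ] (u j * (x * 0ℤ + - u j))
      ≡⟨ cong (x * (x * 1ℤ + - 0ℤ) +_) (trans (sum-cong-≗ λ j → neg (u j) x) (sym (*-distribˡ-sum -1ℤ (λ j → u j * u j)))) ⟩
    x * (x * 1ℤ + - 0ℤ) + -1ℤ * inner u u
      ≡⟨ cong (λ z → x * (x * 1ℤ + - 0ℤ) + -1ℤ * z) u² ⟩
    x * (x * 1ℤ + - 0ℤ) + -1ℤ * ℤ.+ k
      ≡⟨ tidy x (ℤ.+ k) ⟩
    x * x + - (ℤ.+ k) ∎
    where
    neg : ∀ u x → u * (x * 0ℤ + - u) ≡ -1ℤ * (u * u)
    neg = solve-∀
    tidy : ∀ x k → x * (x * 1ℤ + - 0ℤ) + -1ℤ * k ≡ x * x + - k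
    tidy = solve-∀
  first : altSign 0 * ((x * C zero zero + rows zero) * detℤ n (charMatrix (adj G) x)) ≡ (x * x + - (ℤ.+ k)) * detℤ n (charMatrix (adj G) x)
  first = trans (*-identityˡ _) (cong (_* detℤ n (charMatrix (adj G) x)) head-value)
  tail-zero : ∀ c → x * C zero (suc c) + rows (suc c) ≡ 0ℤ
  tail-zero c = begin
    x * (x * 0ℤ + - u c) + ∑[ j < n ] (u j * (x * δ j c + - adj G j c))
      ≡⟨ cong (x * (x * 0ℤ + - u c) +_) (sum-linear x λ j → split (u j) x (δ j c) (adj G j c)) ⟩
    x * (x * 0ℤ + - u c) + (x * ∑[ j < n ] (u j * δ j c) + ∑[ j < n ] (-1ℤ * (adj G j c * u j)))
      ≡⟨ cong₂ (λ p q → x * (x * 0ℤ + - u c) + (x * p + q)) (sum-δʳ u c)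
           (trans (sym (*-distribˡ-sum -1ℤ (λ j → adj G j c * u j)))
             (cong (-1ℤ *_) (trans (sum-cong-≗ λ j → cong (_* u j) (symmetric G j c)) (Au≗0 c)))) ⟩
    x * (x * 0ℤ + - u c) + (x * u c + -1ℤ * 0ℤ)
      ≡⟨ cancel x (u c) ⟩
    0ℤ ∎
    where
    split : ∀ u x d a → u * (x * d + - a) ≡ x * (u * d) + -1ℤ * (a * u)
    split = solve-∀
    cancel : ∀ x u → x * (x * 0ℤ + - u) + (x * u + -1ℤ * 0ℤ) ≡ 0ℤ
    cancel = solve-∀

bordered-charPoly : (k m : ℕ) (G : SignedGraph n) → charPoly G ≈P (X *P (X²-k k ^P m)) →
  (u : Vector n) (b : BorderVector G k u) → charPoly (bordered G u (proj₁ b)) ≈P (X²-k k ^P suc m)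
bordered-charPoly {n} k m G char u b = eval-injective (charPoly H) (X²-k k ^P suc m) λ y → let x = ℤ.+[1+ y ] in
  -- The extra factor x of `bordered-det` matches the factor X of the characteristic polynomial of G
  -- and cancels, x being positive.
  *-cancelˡ-≡ x (eval (charPoly H) x) (eval (X²-k k ^P suc m) x) (begin
    x * eval (charPoly H) x
      ≡⟨ cong (x *_) (eval-charPolyOf (adj H) x) ⟩
    x * detℤ (suc n) (charMatrix (adj H) x)
      ≡⟨ bordered-det k G u b x ⟩
    (x * x + - (ℤ.+ k)) * detℤ n (charMatrix (adj G) x)
      ≡⟨ cong ((x * x + - (ℤ.+ k)) *_) (trans (sym (eval-charPolyOf (adj G) x))
           (trans (eval-cong (charPoly G) (X *P (X²-k k ^P m)) x char) (eval-X*[X²-k]^m k m x))) ⟩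
    (x * x + - (ℤ.+ k)) * (x * (x * x + - (ℤ.+ k)) ℤ.^ m)
      ≡⟨ swap (x * x + - (ℤ.+ k)) x ((x * x + - (ℤ.+ k)) ℤ.^ m) ⟩
    x * (x * x + - (ℤ.+ k)) ℤ.^ suc m
      ≡⟨ cong (x *_) (trans (eval-^P (X²-k k) (suc m) x) (cong (ℤ._^ suc m) (eval-X²-k k x))) ⟨
    x * eval (X²-k k ^P suc m) x ∎)
  where
  H = bordered G u (proj₁ b)
  swap : ∀ a x p → a * (x * p) ≡ x * (a * p)
  swap = solve-∀

borderVector : (k m : ℕ) (G : SignedGraph n) → charPoly G ≈P (X *P (X²-k k ^P m)) →
  (∀ i → (degree G i ≡ k) ⊎ (degree G i ≡ k ∸ 1)) → ∃ (BorderVector G k)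
-- For k = 0 the new vertex is isolated: the zero vector has squared norm k.
borderVector {n} zero m G char deg =
  const 0ℤ , (λ i → inj₁ refl) , ·-zero (adj G) (λ _ → refl) , inner-zeroˡ {n} {v = const 0ℤ} (const 0ℤ) (λ _ → refl)
borderVector (suc k) m G char deg = Border.border k m G char deg

theorem5p2 : (k m n : ℕ) (G : SignedGraph n) →
    charPoly G ≈P (X *P (X²-k k ^P m)) →
    (∀ i → (degree G i ≡ k) ⊎ (degree G i ≡ k ∸ 1)) →
    Σ (SignedGraph (suc n)) λ H → Σ (Fin (suc n)) λ v →
    (charPoly H ≈P (X²-k k ^P suc m)) × DeletionYields H v G
theorem5p2 k m n G char deg =
  let (u , b) = borderVector k m G char deg
  in bordered G u (proj₁ b) , zero , bordered-charPoly k m G char u b , λ r c → refl
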